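{- Let ${\bf B}$ be Kimberling's infinite binary word, with positions indexed starting at $1$. For $n\ge 1$ let $I_0(n)$ (respectively $I_1(n)$) be the position of the $n$'th occurrence of the letter $0$ (respectively $1$) in ${\bf B}$. Let $\psi=1.8392867552\cdots$ be the unique real zero of $X^3-X^2-X-1$, and let $\gamma=(\psi^2+1)/2=2.19148788\cdots$. Then for all $n\ge 1$ we have (a) $\lfloor \psi n\rfloor-2\le I_0(n)\le \lfloor \psi n\rfloor+2$; (b) $\lfloor \gamma n\rfloor-1\le I_1(n)\le \lfloor \gamma n\rfloor+3$.
   Context: Definition of ${\bf B}$: Let $B_0=00$. Given a binary word $B_i$, factor it into blocks: each letter $1$ is a block by itself, and each maximal run of consecutive $0$'s is a block, which is either $0$ or $00$ (runs of three or more $0$'s never occur). Then $B_{i+1}$ is obtained by replacing each block $0$ by $0$, each block $1$ by $10$, and each block $00$ by $0101$. For example $B_1=0101$, $B_2=010010$, $B_3=0100101100$. For $i\ge 2$, $B_i$ is a prefix of $B_{i+1}$, and ${\bf B}=0100101100\cdots$ is the unique infinite word having all $B_i$, $i\ge 2$, as prefixes. With indexing from $1$, the first letter of ${\bf B}$ is at position $1$, so e.g. $I_0(1)=1$, $I_1(1)=2$. -}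

module Defs where

open import Data.Empty using (⊥)
open import Data.Fin using (Fin; fromℕ<; _≟_)
open import Data.Fin.Patterns using (0F; 1F)
open import Data.Integer as ℤ using (ℤ; +_)
open import Data.List using (List; []; _∷_; _++_; length; lookup; concatMap; applyUpTo; filter)
open import Data.List.Properties using (concatMap-++; length-++)
open import Data.Nat as ℕ using (ℕ; zero; suc; z≤n; s≤s)
import Data.Nat.Properties as ℕ
open import Data.Product using (∃-syntax; _×_; _,_)
open import Data.Rational as ℚ using (ℚ; 0ℚ; 1ℚ; ½; _/_; ∣_∣; 1/_; Positive)
import Data.Rational.Properties as ℚ
import Data.Rational.Solver as ℚ
open import Relation.Binary.PropositionalEquality
  using (_≡_; refl; sym; trans; cong; cong₂; subst)

------------------------------------------------------------------------
-- The real numbers, as Cauchy sequences of rationals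

IsCauchy : (ℕ → ℚ) → Set
IsCauchy s = ∀ ε → 0ℚ ℚ.< ε →
  ∃[ N ] (∀ m n → N ℕ.≤ m → N ℕ.≤ n → ∣ s m ℚ.- s n ∣ ℚ.< ε)

record ℝ : Set where
  constructor mkℝ
  field
    seq    : ℕ → ℚ
    cauchy : IsCauchy seq

open ℝ public

infix 4 _≃ᵣ_ _≤ᵣ_ _<ᵣ_

_≃ᵣ_ : ℝ → ℝ → Set
x ≃ᵣ y = ∀ ε → 0ℚ ℚ.< ε →
  ∃[ N ] (∀ n → N ℕ.≤ n → ∣ seq x n ℚ.- seq y n ∣ ℚ.< ε)

_≤ᵣ_ : ℝ → ℝ → Set
x ≤ᵣ y = ∀ ε → 0ℚ ℚ.< ε →
  ∃[ N ] (∀ n → N ℕ.≤ n → seq x n ℚ.≤ seq y n ℚ.+ ε)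

_<ᵣ_ : ℝ → ℝ → Set
x <ᵣ y = ∃[ ε ] (0ℚ ℚ.< ε ×
  ∃[ N ] (∀ n → N ℕ.≤ n → seq x n ℚ.+ ε ℚ.≤ seq y n))

pos-* : ∀ {p q} → 0ℚ ℚ.< p → 0ℚ ℚ.< q → 0ℚ ℚ.< p ℚ.* q
pos-* {p} {q} 0<p 0<q =
  ℚ.positive⁻¹ (p ℚ.* q) {{ℚ.pos*pos⇒pos p {{ℚ.positive 0<p}} q {{ℚ.positive 0<q}}}}

half-pos : ∀ {ε} → 0ℚ ℚ.< ε → 0ℚ ℚ.< ½ ℚ.* ε
half-pos = pos-* (ℚ.positive⁻¹ ½)

halves : ∀ ε → ½ ℚ.* ε ℚ.+ ½ ℚ.* ε ≡ ε
halves ε = trans (sym (ℚ.*-distribʳ-+ ε ½ ½)) (ℚ.*-identityˡ ε)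

module _ where
  open ℚ.+-*-Solver

  cancel : ∀ a b → a ≡ (a ℚ.- b) ℚ.+ b
  cancel = solve 2 (λ a b → a := (a :- b) :+ b) refl

  sum-difference : ∀ a b c d → (a ℚ.+ b) ℚ.- (c ℚ.+ d) ≡ (a ℚ.- c) ℚ.+ (b ℚ.- d)
  sum-difference = solve 4 (λ a b c d → (a :+ b) :- (c :+ d) := (a :- c) :+ (b :- d)) refl

  product-difference : ∀ a b c d → a ℚ.* b ℚ.- c ℚ.* d ≡ b ℚ.* (a ℚ.- c) ℚ.+ c ℚ.* (b ℚ.- d)
  product-difference = solve 4 (λ a b c d → a :* b :- c :* d := b :* (a :- c) :+ c :* (b :- d)) refl

const-cauchy : ∀ q → IsCauchy (λ _ → q)
const-cauchy q ε 0<ε = 0 , λ _ _ _ _ →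
  subst (ℚ._< ε) (sym (cong ∣_∣ (ℚ.+-inverseʳ q))) 0<ε

+-cauchy : ∀ {s t} → IsCauchy s → IsCauchy t → IsCauchy (λ n → s n ℚ.+ t n)
+-cauchy {s} {t} cs ct ε 0<ε
  with N₁ , h₁ ← cs (½ ℚ.* ε) (half-pos 0<ε)
     | N₂ , h₂ ← ct (½ ℚ.* ε) (half-pos 0<ε)
  = N₁ ℕ.⊔ N₂ , bound
  where
  open ℚ.≤-Reasoning
  bound : ∀ m n → N₁ ℕ.⊔ N₂ ℕ.≤ m → N₁ ℕ.⊔ N₂ ℕ.≤ n →
          ∣ (s m ℚ.+ t m) ℚ.- (s n ℚ.+ t n) ∣ ℚ.< ε
  bound m n N≤m N≤n = begin-strict
    ∣ (s m ℚ.+ t m) ℚ.- (s n ℚ.+ t n) ∣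
      ≡⟨ cong ∣_∣ (sum-difference (s m) (t m) (s n) (t n)) ⟩
    ∣ (s m ℚ.- s n) ℚ.+ (t m ℚ.- t n) ∣
      ≤⟨ ℚ.∣p+q∣≤∣p∣+∣q∣ (s m ℚ.- s n) (t m ℚ.- t n) ⟩
    ∣ s m ℚ.- s n ∣ ℚ.+ ∣ t m ℚ.- t n ∣
      <⟨ ℚ.+-mono-< (h₁ m n (ℕ.m⊔n≤o⇒m≤o N₁ N₂ N≤m) (ℕ.m⊔n≤o⇒m≤o N₁ N₂ N≤n))
                    (h₂ m n (ℕ.m⊔n≤o⇒n≤o N₁ N₂ N≤m) (ℕ.m⊔n≤o⇒n≤o N₁ N₂ N≤n)) ⟩
    ½ ℚ.* ε ℚ.+ ½ ℚ.* ε
      ≡⟨ halves ε ⟩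
    ε ∎

neg-cauchy : ∀ {s} → IsCauchy s → IsCauchy (λ n → ℚ.- s n)
neg-cauchy {s} cs ε 0<ε with N , h ← cs ε 0<ε = N , λ m n N≤m N≤n →
  subst (ℚ._< ε)
    (trans (sym (ℚ.∣-p∣≡∣p∣ (s m ℚ.- s n))) (cong ∣_∣ (ℚ.neg-distrib-+ (s m) (ℚ.- s n))))
    (h m n N≤m N≤n)

eventually-bounded : ∀ {s} → IsCauchy s →
  ∃[ M ] (0ℚ ℚ.< M × ∃[ N ] (∀ n → N ℕ.≤ n → ∣ s n ∣ ℚ.≤ M))
eventually-bounded {s} cs with N , h ← cs 1ℚ (ℚ.positive⁻¹ 1ℚ) =
    1ℚ ℚ.+ ∣ s N ∣
  , ℚ.+-mono-<-≤ (ℚ.positive⁻¹ 1ℚ) (ℚ.0≤∣p∣ (s N))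
  , N , bound
  where
  open ℚ.≤-Reasoning
  bound : ∀ n → N ℕ.≤ n → ∣ s n ∣ ℚ.≤ 1ℚ ℚ.+ ∣ s N ∣
  bound n N≤n = begin
    ∣ s n ∣                       ≡⟨ cong ∣_∣ (cancel (s n) (s N)) ⟩
    ∣ (s n ℚ.- s N) ℚ.+ s N ∣     ≤⟨ ℚ.∣p+q∣≤∣p∣+∣q∣ (s n ℚ.- s N) (s N) ⟩
    ∣ s n ℚ.- s N ∣ ℚ.+ ∣ s N ∣   ≤⟨ ℚ.+-monoˡ-≤ ∣ s N ∣ (ℚ.<⇒≤ (h n N N≤n ℕ.≤-refl)) ⟩
    1ℚ ℚ.+ ∣ s N ∣                ∎

divide : ∀ {ε M} → 0ℚ ℚ.< ε → 0ℚ ℚ.< M → ∃[ δ ] (0ℚ ℚ.< δ × M ℚ.* δ ≡ ε)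
divide {ε} {M} 0<ε 0<M = M⁻¹ ℚ.* ε , pos-* 0<M⁻¹ 0<ε , eq
  where
  instance
    M>0 : Positive M
    M>0 = ℚ.positive 0<M
  M⁻¹ : ℚ
  M⁻¹ = (1/ M) {{ℚ.pos⇒nonZero M}}
  0<M⁻¹ : 0ℚ ℚ.< M⁻¹
  0<M⁻¹ = ℚ.positive⁻¹ M⁻¹ {{ℚ.1/pos⇒pos M}}
  eq : M ℚ.* (M⁻¹ ℚ.* ε) ≡ ε
  eq = trans (sym (ℚ.*-assoc M M⁻¹ ε))
      (trans (cong (ℚ._* ε) (ℚ.*-inverseʳ M {{ℚ.pos⇒nonZero M}})) (ℚ.*-identityˡ ε))

∣*∣-bound : ∀ a b {M δ} → 0ℚ ℚ.< M → ∣ a ∣ ℚ.≤ M → ∣ b ∣ ℚ.< δ → ∣ a ℚ.* b ∣ ℚ.< M ℚ.* δ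
∣*∣-bound a b {M} {δ} 0<M a≤M b<δ = begin-strict
  ∣ a ℚ.* b ∣       ≡⟨ ℚ.∣p*q∣≡∣p∣*∣q∣ a b ⟩
  ∣ a ∣ ℚ.* ∣ b ∣   ≤⟨ ℚ.*-monoʳ-≤-nonNeg ∣ b ∣ {{ℚ.nonNegative (ℚ.0≤∣p∣ b)}} a≤M ⟩
  M ℚ.* ∣ b ∣       <⟨ ℚ.*-monoʳ-<-pos M {{ℚ.positive 0<M}} b<δ ⟩
  M ℚ.* δ           ∎
  where open ℚ.≤-Reasoning

*-cauchy : ∀ {s t} → IsCauchy s → IsCauchy t → IsCauchy (λ n → s n ℚ.* t n)
*-cauchy {s} {t} cs ct ε 0<ε =
  let S , 0<S , K₁ , s≤S = eventually-bounded cs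
      T , 0<T , K₂ , t≤T = eventually-bounded ct
      δ , 0<δ , Tδ = divide (half-pos 0<ε) 0<T
      η , 0<η , Sη = divide (half-pos 0<ε) 0<S
      N₁ , h₁ = cs δ 0<δ
      N₂ , h₂ = ct η 0<η
      K = K₁ ℕ.⊔ K₂
      N = N₁ ℕ.⊔ N₂
      K₁≤ : ∀ {k} → K ℕ.⊔ N ℕ.≤ k → K₁ ℕ.≤ k
      K₁≤ le = ℕ.m⊔n≤o⇒m≤o K₁ K₂ (ℕ.m⊔n≤o⇒m≤o K N le)
      K₂≤ : ∀ {k} → K ℕ.⊔ N ℕ.≤ k → K₂ ℕ.≤ k
      K₂≤ le = ℕ.m⊔n≤o⇒n≤o K₁ K₂ (ℕ.m⊔n≤o⇒m≤o K N le)
      N₁≤ : ∀ {k} → K ℕ.⊔ N ℕ.≤ k → N₁ ℕ.≤ k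
      N₁≤ le = ℕ.m⊔n≤o⇒m≤o N₁ N₂ (ℕ.m⊔n≤o⇒n≤o K N le)
      N₂≤ : ∀ {k} → K ℕ.⊔ N ℕ.≤ k → N₂ ℕ.≤ k
      N₂≤ le = ℕ.m⊔n≤o⇒n≤o N₁ N₂ (ℕ.m⊔n≤o⇒n≤o K N le)
  in K ℕ.⊔ N , λ m n ≤m ≤n →
    bound (s m) (t m) (s n) (t n) 0<S 0<T Tδ Sη
      (s≤S n (K₁≤ ≤n)) (t≤T m (K₂≤ ≤m)) (h₁ m n (N₁≤ ≤m) (N₁≤ ≤n)) (h₂ m n (N₂≤ ≤m) (N₂≤ ≤n))
  where
  open ℚ.≤-Reasoning
  bound : ∀ a b c d {S T δ η} → 0ℚ ℚ.< S → 0ℚ ℚ.< T →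
          T ℚ.* δ ≡ ½ ℚ.* ε → S ℚ.* η ≡ ½ ℚ.* ε →
          ∣ c ∣ ℚ.≤ S → ∣ b ∣ ℚ.≤ T → ∣ a ℚ.- c ∣ ℚ.< δ → ∣ b ℚ.- d ∣ ℚ.< η →
          ∣ a ℚ.* b ℚ.- c ℚ.* d ∣ ℚ.< ε
  bound a b c d {S} {T} {δ} {η} 0<S 0<T Tδ Sη c≤S b≤T a-c<δ b-d<η = begin-strict
    ∣ a ℚ.* b ℚ.- c ℚ.* d ∣
      ≡⟨ cong ∣_∣ (product-difference a b c d) ⟩
    ∣ b ℚ.* (a ℚ.- c) ℚ.+ c ℚ.* (b ℚ.- d) ∣
      ≤⟨ ℚ.∣p+q∣≤∣p∣+∣q∣ (b ℚ.* (a ℚ.- c)) (c ℚ.* (b ℚ.- d)) ⟩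
    ∣ b ℚ.* (a ℚ.- c) ∣ ℚ.+ ∣ c ℚ.* (b ℚ.- d) ∣
      <⟨ ℚ.+-mono-< (∣*∣-bound b (a ℚ.- c) 0<T b≤T a-c<δ) (∣*∣-bound c (b ℚ.- d) 0<S c≤S b-d<η) ⟩
    T ℚ.* δ ℚ.+ S ℚ.* η
      ≡⟨ cong₂ ℚ._+_ Tδ Sη ⟩
    ½ ℚ.* ε ℚ.+ ½ ℚ.* ε
      ≡⟨ halves ε ⟩
    ε ∎

fromℚ : ℚ → ℝ
fromℚ q = mkℝ (λ _ → q) (const-cauchy q)

fromℤ : ℤ → ℝ
fromℤ i = fromℚ (i / 1)

fromℕ : ℕ → ℝ
fromℕ n = fromℤ (+ n)

infixl 6 _+ᵣ_ _-ᵣ_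
infixl 7 _*ᵣ_
infixr 8 -ᵣ_ _^ᵣ_

_+ᵣ_ : ℝ → ℝ → ℝ
x +ᵣ y = mkℝ (λ n → seq x n ℚ.+ seq y n) (+-cauchy {seq x} {seq y} (cauchy x) (cauchy y))

-ᵣ_ : ℝ → ℝ
-ᵣ x = mkℝ (λ n → ℚ.- seq x n) (neg-cauchy {seq x} (cauchy x))

_-ᵣ_ : ℝ → ℝ → ℝ
x -ᵣ y = x +ᵣ (-ᵣ y)

_*ᵣ_ : ℝ → ℝ → ℝ
x *ᵣ y = mkℝ (λ n → seq x n ℚ.* seq y n) (*-cauchy {seq x} {seq y} (cauchy x) (cauchy y))

_^ᵣ_ : ℝ → ℕ → ℝ
x ^ᵣ zero  = fromℕ 1
x ^ᵣ suc k = x *ᵣ x ^ᵣ k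

-- A relation, since the floor is not a computable function of a real.
⌊_⌋≡_ : ℝ → ℤ → Set
⌊ x ⌋≡ m = fromℤ m ≤ᵣ x × x <ᵣ fromℤ (m ℤ.+ + 1)

------------------------------------------------------------------------
-- Kimberling's word

Letter : Set
Letter = Fin 2

Word : Set
Word = List Letter

data Block : Set where
  [0] [1] [00] : Block

-- Runs are cut greedily from the left.  In a word without three
-- consecutive 0's, such as every B i below, the blocks [0] and [00] are
-- therefore exactly the maximal runs of 0's.
factor : Word → List Block
factor []             = []
factor (1F ∷ w)       = [1] ∷ factor w
factor (0F ∷ 0F ∷ w)  = [00] ∷ factor w
factor (0F ∷ [])      = [0] ∷ []
factor (0F ∷ 1F ∷ w)  = [0] ∷ [1] ∷ factor w

replace : Block → Word
replace [0]  = 0F ∷ []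
replace [1]  = 1F ∷ 0F ∷ []
replace [00] = 0F ∷ 1F ∷ 0F ∷ 1F ∷ []

step : Word → Word
step w = concatMap replace (factor w)

B : ℕ → Word
B zero    = 0F ∷ 0F ∷ []
B (suc i) = step (B i)

factor-++ : ∀ w v → factor (w ++ 1F ∷ v) ≡ factor w ++ [1] ∷ factor v
factor-++ []            v = refl
factor-++ (1F ∷ w)      v = cong ([1] ∷_) (factor-++ w v)
factor-++ (0F ∷ [])     v = refl
factor-++ (0F ∷ 0F ∷ w) v = cong ([00] ∷_) (factor-++ w v)
factor-++ (0F ∷ 1F ∷ w) v = cong (λ bs → [0] ∷ [1] ∷ bs) (factor-++ w v)

-- B (3 + i) extends B (2 + i) by a word beginning with 1.
B-extends : ∀ i → ∃[ v ] B (3 ℕ.+ i) ≡ B (2 ℕ.+ i) ++ 1F ∷ v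
B-extends zero    = 1F ∷ 0F ∷ 0F ∷ [] , refl
B-extends (suc i) with v , eq ← B-extends i =
    0F ∷ step v
  , trans (cong step eq)
   (trans (cong (concatMap replace) (factor-++ (B (2 ℕ.+ i)) v))
          (concatMap-++ replace (factor (B (2 ℕ.+ i))) ([1] ∷ factor v)))

length-B : ∀ i → i ℕ.< length (B (2 ℕ.+ i))
length-B zero    = s≤s z≤n
length-B (suc i) with v , eq ← B-extends i = begin-strict
  suc i                                       ≤⟨ length-B i ⟩
  length (B (2 ℕ.+ i))                        <⟨ ℕ.m<m+n _ (s≤s z≤n) ⟩
  length (B (2 ℕ.+ i)) ℕ.+ length (1F ∷ v)    ≡⟨ sym (length-++ (B (2 ℕ.+ i))) ⟩
  length (B (2 ℕ.+ i) ++ 1F ∷ v)              ≡⟨ sym (cong length eq) ⟩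
  length (B (3 ℕ.+ i))                        ∎
  where open ℕ.≤-Reasoning

-- 𝐁 k is the letter at position k + 1; it is read off B (2 + k), which is
-- long enough.  By 𝐁-prefix and 𝐁-unique this is the infinite word having
-- all B i with i ≥ 2 as prefixes.
𝐁 : ℕ → Letter
𝐁 k = lookup (B (2 ℕ.+ k)) (fromℕ< (length-B k))

lookup-++ : ∀ (w u : Word) {k} (p : k ℕ.< length w) (q : k ℕ.< length (w ++ u)) →
            lookup w (fromℕ< p) ≡ lookup (w ++ u) (fromℕ< q)
lookup-++ (a ∷ w) u {zero}  p       q       = refl
lookup-++ (a ∷ w) u {suc k} (s≤s p) (s≤s q) = lookup-++ w u p q

lookup-≡ : ∀ {w w′ : Word} → w ≡ w′ → ∀ {k} (p : k ℕ.< length w) (q : k ℕ.< length w′) →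
           lookup w (fromℕ< p) ≡ lookup w′ (fromℕ< q)
lookup-≡ {w} refl p q = cong (λ r → lookup w (fromℕ< r)) (ℕ.<-irrelevant p q)

B-agree : ∀ d i {k} (p : k ℕ.< length (B (2 ℕ.+ i))) (q : k ℕ.< length (B (2 ℕ.+ (d ℕ.+ i)))) →
          lookup (B (2 ℕ.+ i)) (fromℕ< p) ≡ lookup (B (2 ℕ.+ (d ℕ.+ i))) (fromℕ< q)
B-agree zero    i p q = lookup-≡ {B (2 ℕ.+ i)} refl p q
B-agree (suc d) i {k} p q with v , eq ← B-extends (d ℕ.+ i) =
  trans (B-agree d i p p′) (trans (lookup-++ w (1F ∷ v) p′ p″) (lookup-≡ (sym eq) p″ q))
  where
  w = B (2 ℕ.+ (d ℕ.+ i))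
  grow : ∀ d → k ℕ.< length (B (2 ℕ.+ (d ℕ.+ i)))
  grow zero    = p
  grow (suc d) with v , eq ← B-extends (d ℕ.+ i) =
    subst (λ l → k ℕ.< length l) (sym eq)
      (subst (k ℕ.<_) (sym (length-++ (B (2 ℕ.+ (d ℕ.+ i))))) (ℕ.m≤n⇒m≤n+o _ (grow d)))
  p′ : k ℕ.< length w
  p′ = grow d
  p″ : k ℕ.< length (w ++ 1F ∷ v)
  p″ = subst (λ l → k ℕ.< length l) eq q

HasPrefix : (ℕ → Letter) → Word → Set
HasPrefix x w = ∀ {k} (k<∣w∣ : k ℕ.< length w) → x k ≡ lookup w (fromℕ< k<∣w∣)

𝐁-prefix : ∀ i → HasPrefix 𝐁 (B (2 ℕ.+ i))
𝐁-prefix i {k} p =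
  trans (B-agree i k (length-B k) q)
  (trans (lookup-≡ (cong (λ j → B (2 ℕ.+ j)) (ℕ.+-comm i k)) q q′) (sym (B-agree k i p q′)))
  where
  q′ : k ℕ.< length (B (2 ℕ.+ (k ℕ.+ i)))
  q′ = ℕ.<-≤-trans (ℕ.s≤s (ℕ.m≤m+n k i)) (length-B (k ℕ.+ i))
  q : k ℕ.< length (B (2 ℕ.+ (i ℕ.+ k)))
  q = subst (λ j → k ℕ.< length (B (2 ℕ.+ j))) (ℕ.+-comm k i) q′

𝐁-unique : ∀ x → (∀ i → HasPrefix x (B (2 ℕ.+ i))) → ∀ k → x k ≡ 𝐁 k
𝐁-unique x h k = h k (length-B k)

#occurrences : Letter → ℕ → ℕ
#occurrences a p = length (filter (_≟ a) (applyUpTo 𝐁 p))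

-- I a [ n ]≡ p : the n-th occurrence of a in 𝐁 is at position p.  Positions
-- start at 1, so the letter at position suc k is 𝐁 k.
I_[_]≡_ : Letter → ℕ → ℕ → Set
I a [ n ]≡ zero  = ⊥
I a [ n ]≡ suc k = 𝐁 k ≡ a × #occurrences a (suc k) ≡ n

{-# OPTIONS --safe #-}
module Submission where

-- Without its first letter, 𝐁 factors into the blocks 1, 10, 100, on which
-- step acts as 1 ↦ 10 ↦ 100 ↦ 100 10 1, so that it is a limit of the words
-- T (3 + k) = T (2 + k) T (1 + k) T k.  For a word w with n zeros put
-- Δ(w) = |w| - ψn.  On the T k this functional satisfies the Tribonacci
-- recurrence without a component along ψ^k, hence decays geometrically.  A
-- prefix of T (1 + k) is a prefix of T k or T k followed by a prefix of T k,
-- so Δ is bounded on all prefixes of 𝐁.  On the prefix of length p, Δ equals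
-- p - ψn if it has n zeros, and (ψ - 1)(γn - p) if it has n ones.
--
-- All of this is computed with rational approximations q of ψ, for which the
-- identities hold up to multiples of χ(q) = q³ - q² - q - 1, and hence for the
-- terms q of the Cauchy sequence ψ from some index on.

open import Defs
open import Data.Fin using (_≟_)
open import Data.Fin.Patterns using (0F; 1F)
open import Data.Integer as ℤ using (ℤ; +_)
import Data.Integer.Properties as ℤ
open import Data.Integer.Tactic.RingSolver using () renaming (solve-∀ to ℤ-solve-∀)
open import Data.List using ([]; _∷_; _++_; length; concatMap; applyUpTo; filter; take; drop)
open import Data.List.Properties
  using (++-assoc; concatMap-++; filter-++; filter-accept; filter-reject; length-++;
         length-applyUpTo; applyUpTo-∷ʳ; take++drop≡id; take-all; ∷-injective)
open import Data.Nat as ℕ using (ℕ; zero; suc; z≤n; s≤s)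
import Data.Nat.Properties as ℕ
open import Data.Product using (∃-syntax; _×_; _,_; proj₁; proj₂)
open import Data.Rational hiding (_≟_)
open import Data.Rational.Properties hiding (_≟_)
import Data.Rational.Properties as ℚ
import Data.Rational.Solver as ℚ
import Data.Rational.Unnormalised as ℚᵘ
import Data.Rational.Unnormalised.Properties as ℚᵘ
open import Data.Sum using (_⊎_; inj₁; inj₂)
open import Level using (0ℓ)
open import Relation.Binary.PropositionalEquality
open import Relation.Nullary using (yes; no; contradiction)
open import Relation.Nullary.Decidable using (dec⇒maybe; from-yes; _×-dec_)
open import Tactic.RingSolver using (solve-∀)
open import Tactic.RingSolver.Core.AlmostCommutativeRing
  using (AlmostCommutativeRing; fromCommutativeRing)

-- The Tribonacci words `T k` and their relation to `B`

T : ℕ → Word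
T 0 = 1F ∷ []
T 1 = 1F ∷ 0F ∷ []
T 2 = 1F ∷ 0F ∷ 0F ∷ []
T (suc (suc (suc k))) = T (suc (suc k)) ++ T (suc k) ++ T k

T-starts-1 : ∀ k → ∃[ w ] T k ≡ 1F ∷ w
T-starts-1 0 = _ , refl
T-starts-1 1 = _ , refl
T-starts-1 2 = _ , refl
T-starts-1 (suc (suc (suc k))) with T (2 ℕ.+ k) | T-starts-1 (2 ℕ.+ k)
... | _ | w , refl = _ , refl

-- A run of 0's cannot continue into a word that begins with 1, so the factorization into blocks
-- splits at the seam.
step-++ : ∀ w {v v′} → v ≡ 1F ∷ v′ → step (w ++ v) ≡ step w ++ step v
step-++ w {v′ = v′} refl =
  trans (cong (concatMap replace) (factor-++ w v′))
        (concatMap-++ replace (factor w) ([1] ∷ factor v′))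

step-T : ∀ k → step (T k) ≡ T (suc k)
step-T 0 = refl
step-T 1 = refl
step-T 2 = refl
step-T (suc (suc (suc k))) = begin
  step (T (suc (suc k)) ++ T (suc k) ++ T k)
    ≡⟨ step-++ (T (suc (suc k))) (cong (_++ T k) (proj₂ (T-starts-1 (suc k)))) ⟩
  step (T (suc (suc k))) ++ step (T (suc k) ++ T k)
    ≡⟨ cong (step (T (suc (suc k))) ++_) (step-++ (T (suc k)) (proj₂ (T-starts-1 k))) ⟩
  step (T (suc (suc k))) ++ step (T (suc k)) ++ step (T k)
    ≡⟨ cong₂ _++_ (step-T (suc (suc k))) (cong₂ _++_ (step-T (suc k)) (step-T k)) ⟩
  T (suc (suc (suc k))) ++ T (suc (suc k)) ++ T (suc k) ∎
  where open ≡-Reasoning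

-- The leading 0 is followed by a 1, hence is a block of its own and is fixed by `step`; rewriting
-- `T (2 + i)` as `1F ∷ w` lets `factor` compute this. On the rest `step` acts by `step-T`.
B-T : ∀ i → B (2 ℕ.+ i) ≡ 0F ∷ T (2 ℕ.+ i) ++ T (1 ℕ.+ i)
B-T zero = refl
B-T (suc i) with w , eq ← T-starts-1 (2 ℕ.+ i) | w′ , eq′ ← T-starts-1 (1 ℕ.+ i) = begin
  step (B (2 ℕ.+ i))
    ≡⟨ cong step (B-T i) ⟩
  step (0F ∷ T (2 ℕ.+ i) ++ T (1 ℕ.+ i))
    ≡⟨ cong (λ u → step (0F ∷ u ++ T (1 ℕ.+ i))) eq ⟩
  0F ∷ step (1F ∷ w ++ T (1 ℕ.+ i))
    ≡⟨ cong (λ u → 0F ∷ step (u ++ T (1 ℕ.+ i))) eq ⟨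
  0F ∷ step (T (2 ℕ.+ i) ++ T (1 ℕ.+ i))
    ≡⟨ cong (0F ∷_) (step-++ (T (2 ℕ.+ i)) eq′) ⟩
  0F ∷ step (T (2 ℕ.+ i)) ++ step (T (1 ℕ.+ i))
    ≡⟨ cong (0F ∷_) (cong₂ _++_ (step-T (2 ℕ.+ i)) (step-T (1 ℕ.+ i))) ⟩
  0F ∷ T (3 ℕ.+ i) ++ T (2 ℕ.+ i) ∎
  where open ≡-Reasoning

-- Prefixes

infix 4 _≼_

_≼_ : Word → Word → Set
u ≼ w = ∃[ v ] u ++ v ≡ w

≼-trans : ∀ {u v w} → u ≼ v → v ≼ w → u ≼ w
≼-trans {u} (x , refl) (y , refl) = x ++ y , sym (++-assoc u x y)

≼-++ : ∀ {u} a {b} → u ≼ a ++ b → u ≼ a ⊎ ∃[ u′ ] (u ≡ a ++ u′ × u′ ≼ b)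
≼-++ {u}     []      u≼b           = inj₂ (u , refl , u≼b)
≼-++ {[]}    (x ∷ a) _             = inj₁ (x ∷ a , refl)
≼-++ {y ∷ u} (x ∷ a) (v , eq) with refl , eq′ ← ∷-injective eq | ≼-++ a (v , eq′)
... | inj₁ (v′ , refl)        = inj₁ (v′ , refl)
... | inj₂ (u′ , refl , u′≼b) = inj₂ (u′ , refl , u′≼b)

T-tail : ∀ k → T (2 ℕ.+ k) ++ T (1 ℕ.+ k) ≼ T (3 ℕ.+ k)
T-tail k = T k , ++-assoc (T (2 ℕ.+ k)) (T (1 ℕ.+ k)) (T k)

B≼T : ∀ i → B (2 ℕ.+ i) ≼ 0F ∷ T (3 ℕ.+ i)
B≼T i with v , eq ← T-tail i =
  v , trans (cong (_++ v) (B-T i)) (cong (0F ∷_) eq)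

applyUpTo-take : ∀ {x : ℕ → Letter} w p → HasPrefix x w → p ℕ.≤ length w →
                 applyUpTo x p ≡ take p w
applyUpTo-take w       zero    h _         = refl
applyUpTo-take (a ∷ w) (suc p) h (s≤s p≤w) =
  cong₂ _∷_ (h (s≤s z≤n)) (applyUpTo-take w p (λ k< → h (s≤s k<)) p≤w)

𝐁≼B : ∀ {p} i → p ℕ.≤ length (B (2 ℕ.+ i)) → applyUpTo 𝐁 p ≼ B (2 ℕ.+ i)
𝐁≼B {p} i p≤ = drop p w ,
  trans (cong (_++ drop p w) (applyUpTo-take w p (𝐁-prefix i) p≤)) (take++drop≡id p w)
  where w = B (2 ℕ.+ i)

-- The parameter `d` leaves the index free, so that it can be matched with one at which discrepancy
-- bounds are available.
𝐁≼T : ∀ d p → applyUpTo 𝐁 p ≼ 0F ∷ T (3 ℕ.+ (d ℕ.+ p))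
𝐁≼T d p = ≼-trans
  (𝐁≼B (d ℕ.+ p) (ℕ.≤-trans (ℕ.m≤n+m p d) (ℕ.<⇒≤ (length-B (d ℕ.+ p)))))
  (B≼T (d ℕ.+ p))

-- Letter counts and the existence of every occurrence

# : Letter → Word → ℕ
# a w = length (filter (_≟ a) w)

#-++ : ∀ a u v → # a (u ++ v) ≡ # a u ℕ.+ # a v
#-++ a u v = trans (cong length (filter-++ (_≟ a) u v)) (length-++ (filter (_≟ a) u))

#0+#1≡length : ∀ w → # 0F w ℕ.+ # 1F w ≡ length w
#0+#1≡length []       = refl
#0+#1≡length (0F ∷ w) = cong suc (#0+#1≡length w)
#0+#1≡length (1F ∷ w) = trans (ℕ.+-suc (# 0F w) (# 1F w)) (cong suc (#0+#1≡length w))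

#occurrences-suc : ∀ a p → #occurrences a (suc p) ≡ #occurrences a p ℕ.+ # a (𝐁 p ∷ [])
#occurrences-suc a p = trans (cong (# a) (sym (applyUpTo-∷ʳ 𝐁 p))) (#-++ a (applyUpTo 𝐁 p) (𝐁 p ∷ []))

-- Shortens the prefix until dropping one more letter would bring the count below `suc n`.
I-exists : ∀ a p n → suc n ℕ.≤ #occurrences a p → ∃[ k ] I a [ suc n ]≡ suc k
I-exists a (suc p) n n<# with suc n ℕ.≤? #occurrences a p | 𝐁 p ≟ a
... | yes n<#p | _ = I-exists a p n n<#p
-- At most `n` occurrences precede this letter, and it adds exactly one, so it is the occurrence
-- sought.
... | no  n≮#p | yes 𝐁p≡a = p , 𝐁p≡a , ℕ.≤-antisym #≤ n<#
  where
  open ℕ.≤-Reasoning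
  #≤ : #occurrences a (suc p) ℕ.≤ suc n
  #≤ = begin
    #occurrences a (suc p)                     ≡⟨ #occurrences-suc a p ⟩
    #occurrences a p ℕ.+ # a (𝐁 p ∷ [])        ≡⟨ cong (λ w → #occurrences a p ℕ.+ length w)
                                                       (filter-accept (_≟ a) 𝐁p≡a) ⟩
    #occurrences a p ℕ.+ 1                     ≤⟨ ℕ.+-monoˡ-≤ 1 (ℕ.≮⇒≥ n≮#p) ⟩
    n ℕ.+ 1                                    ≡⟨ ℕ.+-comm n 1 ⟩
    suc n                                      ∎
... | no  n≮#p | no  𝐁p≢a = contradiction (subst (suc n ℕ.≤_) #≡ n<#) n≮#p
  where
  #≡ : #occurrences a (suc p) ≡ #occurrences a p
  #≡ = trans (#occurrences-suc a p)
      (trans (cong (#occurrences a p ℕ.+_) (cong length (filter-reject (_≟ a) 𝐁p≢a)))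
             (ℕ.+-identityʳ _))

-- By the recurrence, `T (4 + n)` contains the occurrences in `T (3 + n)` and at least one more from
-- `T (2 + n)`.
#T-unbounded : ∀ a n → suc n ℕ.≤ # a (T (2 ℕ.+ n))
#T-unbounded 0F 0 = s≤s z≤n
#T-unbounded 1F 0 = s≤s z≤n
#T-unbounded 0F 1 = s≤s (s≤s z≤n)
#T-unbounded 1F 1 = s≤s (s≤s z≤n)
#T-unbounded a (suc (suc n)) = begin
  3 ℕ.+ n
    ≤⟨ ℕ.+-mono-≤ (s≤s {0} {n} z≤n) (#T-unbounded a (suc n)) ⟩
  suc n ℕ.+ # a (T (3 ℕ.+ n))
    ≤⟨ ℕ.+-monoˡ-≤ _ (#T-unbounded a n) ⟩
  # a (T (2 ℕ.+ n)) ℕ.+ # a (T (3 ℕ.+ n))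
    ≡⟨ ℕ.+-comm (# a (T (2 ℕ.+ n))) _ ⟩
  # a (T (3 ℕ.+ n)) ℕ.+ # a (T (2 ℕ.+ n))
    ≡⟨ #-++ a (T (3 ℕ.+ n)) (T (2 ℕ.+ n)) ⟨
  # a (T (3 ℕ.+ n) ++ T (2 ℕ.+ n))
    ≤⟨ ℕ.m≤m+n _ _ ⟩
  # a (T (3 ℕ.+ n) ++ T (2 ℕ.+ n)) ℕ.+ # a (proj₁ (T-tail (suc n)))
    ≡⟨ #-++ a (T (3 ℕ.+ n) ++ T (2 ℕ.+ n)) _ ⟨
  # a ((T (3 ℕ.+ n) ++ T (2 ℕ.+ n)) ++ proj₁ (T-tail (suc n)))
    ≡⟨ cong (# a) (proj₂ (T-tail (suc n))) ⟩
  # a (T (4 ℕ.+ n)) ∎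
  where open ℕ.≤-Reasoning

𝐁-unbounded : ∀ a n → ∃[ p ] suc n ℕ.≤ #occurrences a p
𝐁-unbounded a n = length w , (begin
  suc n                                ≤⟨ #T-unbounded a n ⟩
  # a (T (2 ℕ.+ n))                     ≤⟨ ℕ.m≤m+n _ _ ⟩
  # a (T (2 ℕ.+ n)) ℕ.+ # a (T (1 ℕ.+ n)) ≡⟨ #-++ a (T (2 ℕ.+ n)) _ ⟨
  # a (T (2 ℕ.+ n) ++ T (1 ℕ.+ n))      ≤⟨ ℕ.m≤n+m _ _ ⟩
  # a (0F ∷ []) ℕ.+ # a (T (2 ℕ.+ n) ++ T (1 ℕ.+ n)) ≡⟨ #-++ a (0F ∷ []) _ ⟨
  # a (0F ∷ T (2 ℕ.+ n) ++ T (1 ℕ.+ n)) ≡⟨ cong (# a) (B-T n) ⟨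
  # a w                                 ≡⟨ cong (# a) (take-all (length w) w ℕ.≤-refl) ⟨
  # a (take (length w) w)               ≡⟨ cong (# a) (applyUpTo-take w (length w) (𝐁-prefix n) ℕ.≤-refl) ⟨
  #occurrences a (length w)             ∎)
  where
  open ℕ.≤-Reasoning
  w = B (2 ℕ.+ n)

occurrence : ∀ a n → n ℕ.≥ 1 → ∃[ k ] I a [ n ]≡ suc k
occurrence a (suc n) _ with p , n<# ← 𝐁-unbounded a n = I-exists a p n n<#

-- Inequalities between rationals

ℚ-ring : AlmostCommutativeRing 0ℓ 0ℓ
ℚ-ring = fromCommutativeRing +-*-commutativeRing (λ p → dec⇒maybe (0ℚ ℚ.≟ p))

infixl 6 _⊕_
infixl 7 _⊗_

_⊕_ : ∀ {p q} → 0ℚ ≤ p → 0ℚ ≤ q → 0ℚ ≤ p + q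
_⊕_ = +-mono-≤

_⊗_ : ∀ {p q} → 0ℚ ≤ p → 0ℚ ≤ q → 0ℚ ≤ p * q
_⊗_ {p} {q} 0≤p 0≤q =
  nonNegative⁻¹ (p * q) {{nonNeg*nonNeg⇒nonNeg p {{nonNegative 0≤p}} q {{nonNegative 0≤q}}}}

⟨_⟩ : ∀ p .{{_ : NonNegative p}} → 0ℚ ≤ p
⟨ p ⟩ = nonNegative⁻¹ p

p≤q⇒0≤q-p : ∀ {p q} → p ≤ q → 0ℚ ≤ q - p
p≤q⇒0≤q-p {p} {q} p≤q = subst (_≤ q - p) (+-inverseʳ p) (+-monoˡ-≤ (- p) p≤q)

-- Proof by certificate: `d` is assembled with `_⊕_` and `_⊗_` from nonnegative pieces, and a ring
-- identity equates it with the difference.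
≤-by : ∀ {p q d} → 0ℚ ≤ d → d ≡ q - p → p ≤ q
≤-by {p} {q} 0≤d refl = begin
  p             ≡⟨ +-identityˡ p ⟨
  0ℚ + p        ≤⟨ +-monoˡ-≤ p 0≤d ⟩
  (q - p) + p   ≡⟨ cancel q p ⟨
  q             ∎
  where open ≤-Reasoning

0≤p² : ∀ p → 0ℚ ≤ p * p
0≤p² p with ≤-total 0ℚ p
... | inj₁ 0≤p = 0≤p ⊗ 0≤p
... | inj₂ p≤0 = subst (0ℚ ≤_) (square-neg p) (neg-antimono-≤ p≤0 ⊗ neg-antimono-≤ p≤0)
  where
  square-neg : ∀ p → - p * - p ≡ p * p
  square-neg = solve-∀ ℚ-ring

p≤∣p∣ : ∀ p → p ≤ ∣ p ∣
p≤∣p∣ p with ≤-total 0ℚ p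
... | inj₁ 0≤p = ≤-reflexive (sym (0≤p⇒∣p∣≡p 0≤p))
... | inj₂ p≤0 = ≤-trans p≤0 (0≤∣p∣ p)

swap-neg : ∀ p q → p - (- q) ≡ q - (- p)
swap-neg = solve-∀ ℚ-ring

-p≤∣p∣ : ∀ p → - p ≤ ∣ p ∣
-p≤∣p∣ p = subst (- p ≤_) (∣-p∣≡∣p∣ p) (p≤∣p∣ (- p))

-∣p∣≤p : ∀ p → - ∣ p ∣ ≤ p
-∣p∣≤p p = ≤-by (p≤q⇒0≤q-p (-p≤∣p∣ p)) (swap-neg ∣ p ∣ p)

∣p∣≤q : ∀ {p q} → - q ≤ p → p ≤ q → ∣ p ∣ ≤ q
∣p∣≤q {p} {q} -q≤p p≤q with ∣p∣≡p∨∣p∣≡-p p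
... | inj₁ eq = subst (_≤ q) (sym eq) p≤q
... | inj₂ eq = subst (_≤ q) (sym eq) (≤-by (p≤q⇒0≤q-p -q≤p) (swap-neg p q))

*-cancel-0< : ∀ {p q} → 0ℚ ≤ q → 0ℚ < p * q → 0ℚ < p
*-cancel-0< {p} {q} 0≤q 0<pq =
  *-cancelʳ-<-nonNeg q {{nonNegative 0≤q}} (subst (_< p * q) (sym (*-zeroˡ q)) 0<pq)

0<q-p⇒p<q : ∀ {p q} → 0ℚ < q - p → p < q
0<q-p⇒p<q {p} {q} 0<q-p = subst₂ _<_ (+-identityˡ p) (sym (cancel q p)) (+-monoˡ-< p 0<q-p)

p<q⇒0<q-p : ∀ {p q} → p < q → 0ℚ < q - p
p<q⇒0<q-p {p} {q} p<q = subst (_< q - p) (+-inverseʳ p) (+-monoˡ-< (- p) p<q)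

-- Properties of the terms of a Cauchy sequence

-- A record, so that the predicate can be inferred.
record Eventually (x : ℝ) (P : ℚ → Set) : Set where
  constructor mkEventually
  field
    holds : ∃[ N ] (∀ n → N ℕ.≤ n → P (seq x n))

open Eventually

module _ {x : ℝ} {P Q : ℚ → Set} where

  eventually : (∀ {q} → P q → Q q) → Eventually x P → Eventually x Q
  eventually f (mkEventually (N , p)) = mkEventually (N , λ n N≤n → f (p n N≤n))

  infixr 4 _∧_

  _∧_ : Eventually x P → Eventually x Q → Eventually x (λ q → P q × Q q)
  mkEventually (N , p) ∧ mkEventually (M , q) = mkEventually
    (N ℕ.⊔ M , λ n le → p n (ℕ.m⊔n≤o⇒m≤o N M le) , q n (ℕ.m⊔n≤o⇒n≤o N M le))

Bounded : ℝ → (ℚ → ℚ) → Set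
Bounded x f = ∃[ M ] (0ℚ < M × Eventually x (λ q → ∣ f q ∣ ≤ M))

-- A polynomial in the terms of `x` is bounded because it gives the terms of another real `y`, whose
-- Cauchy property comes with the arithmetic operations.
bounded : ∀ x y {f} → (∀ n → seq y n ≡ f (seq x n)) → Bounded x f
bounded x y eq =
  let M , 0<M , N , ≤M = eventually-bounded {seq y} (cauchy y) in
  M , 0<M , mkEventually (N , λ n N≤n → subst (λ q → ∣ q ∣ ≤ M) (eq n) (≤M n N≤n))

Negligible : ℝ → (ℚ → ℚ) → Set
Negligible x f = ∀ ε → 0ℚ < ε → Eventually x (λ q → ∣ f q ∣ < ε)

module _ (x : ℝ) where

  negligible-+ : ∀ {f g} → Negligible x f → Negligible x g → Negligible x (λ q → f q + g q)
  negligible-+ {f} {g} nf ng ε 0<ε = eventually bound (nf (½ * ε) (half-pos 0<ε) ∧ ng (½ * ε) (half-pos 0<ε))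
    where
    open ≤-Reasoning
    bound : ∀ {q} → ∣ f q ∣ < ½ * ε × ∣ g q ∣ < ½ * ε → ∣ f q + g q ∣ < ε
    bound {q} (f< , g<) = begin-strict
      ∣ f q + g q ∣       ≤⟨ ∣p+q∣≤∣p∣+∣q∣ (f q) (g q) ⟩
      ∣ f q ∣ + ∣ g q ∣   <⟨ +-mono-< f< g< ⟩
      ½ * ε + ½ * ε       ≡⟨ halves ε ⟩
      ε                   ∎

  negligible-* : ∀ {g f} → Bounded x g → Negligible x f → Negligible x (λ q → g q * f q)
  negligible-* {g} {f} (M , 0<M , g≤M) nf ε 0<ε =
    let δ , 0<δ , Mδ≡ε = divide 0<ε 0<M in
    eventually (λ {q} (f< , g≤) → subst (∣ g q * f q ∣ <_) Mδ≡ε (∣*∣-bound (g q) (f q) 0<M g≤ f<))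
                 (nf δ 0<δ ∧ g≤M)

  -- Comparison with x is decided by the sign of a polynomial p vanishing at x
  -- whose divided difference F is positive.
  ≤-or-> : (p : ℚ → ℚ) (F : ℚ → ℚ → ℚ) →
           Negligible x p →
           (∀ t q → p t - p q ≡ (t - q) * F t q) →
           ∀ {κ} → 0ℚ < κ → (∀ t → Eventually x (λ q → κ ≤ F t q)) →
           (∀ t → Bounded x (F t)) →
           ∀ t → fromℚ t ≤ᵣ x ⊎ x <ᵣ fromℚ t
  ≤-or-> p F np factor {κ} 0<κ κ≤F bF t with p t ≤? 0ℚ
  -- If `t` exceeded `q + ε`, the factorization would give κε < |p(q)|; hence the tolerance `κ * ε`.
  ... | yes pt≤0 = inj₁ λ ε 0<ε → holds
    (eventually (λ {q} (small , κ≤) → close ε 0<ε q small κ≤) (np (κ * ε) (pos-* 0<κ 0<ε) ∧ κ≤F t))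
    where
    open ≤-Reasoning
    close : ∀ ε → 0ℚ < ε → ∀ q → ∣ p q ∣ < κ * ε → κ ≤ F t q → t ≤ q + ε
    close ε 0<ε q small κ≤ with t ≤? q + ε
    ... | yes t≤q+ε = t≤q+ε
    ... | no  t≰q+ε = contradiction (begin-strict
      κ * ε             ≤⟨ ≤-by (<⇒≤ 0<κ ⊗ p≤q⇒0≤q-p (<⇒≤ (≰⇒> t≰q+ε)) ⊕ p≤q⇒0≤q-p κ≤ ⊗ 0≤t-q) (rearrange t q ε κ (F t q)) ⟩
      (t - q) * F t q   ≡⟨ factor t q ⟨
      p t - p q         ≤⟨ +-mono-≤ pt≤0 (-p≤∣p∣ (p q)) ⟩
      0ℚ + ∣ p q ∣      ≡⟨ +-identityˡ ∣ p q ∣ ⟩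
      ∣ p q ∣           <⟨ small ⟩
      κ * ε             ∎) (<-irrefl refl)
      where
      0≤t-q : 0ℚ ≤ t - q
      0≤t-q = subst (0ℚ ≤_) (drop-ε t q ε) (p≤q⇒0≤q-p (<⇒≤ (≰⇒> t≰q+ε)) ⊕ <⇒≤ 0<ε)
        where
        drop-ε : ∀ t q ε → t - (q + ε) + ε ≡ t - q
        drop-ε = solve-∀ ℚ-ring
      rearrange : ∀ t q ε κ f → κ * (t - (q + ε)) + (f - κ) * (t - q) ≡ (t - q) * f - κ * ε
      rearrange = solve-∀ ℚ-ring
  ... | no pt≰0
    -- Once |p(q)| is below half of `p t`, the product `(t - q) * F t q` exceeds the other half,
    -- which is `M * δ`; as F is at most `M`, this separates `q` from `t` by `δ`.
    = let M , 0<M , F≤M = bF t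
          δ , 0<δ , Mδ≡ = divide (half-pos (≰⇒> pt≰0)) 0<M in
      inj₂ (δ , 0<δ , holds (eventually (λ {q} (small , κ≤ , ≤M) → apart M δ 0<M 0<δ Mδ≡ q small κ≤ ≤M)
        (np (½ * p t) (half-pos (≰⇒> pt≰0)) ∧ κ≤F t ∧ F≤M)))
    where
    open ≤-Reasoning
    apart : ∀ M δ → 0ℚ < M → 0ℚ < δ → M * δ ≡ ½ * p t → ∀ q → ∣ p q ∣ < ½ * p t → κ ≤ F t q → ∣ F t q ∣ ≤ M → q + δ ≤ t
    apart M δ 0<M 0<δ Mδ≡ q small κ≤ ≤M = ≤-by (p≤q⇒0≤q-p δ≤) (rearrange t q δ)
      where
      Mδ< : M * δ < (t - q) * F t q
      Mδ< = begin-strict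
        M * δ                     ≡⟨ Mδ≡ ⟩
        ½ * p t                   ≡⟨ halve (p t) ⟩
        p t - ½ * p t             <⟨ +-monoʳ-< (p t) (neg-antimono-< (≤-<-trans (p≤∣p∣ (p q)) small)) ⟩
        p t - p q                 ≡⟨ factor t q ⟩
        (t - q) * F t q           ∎
        where
        halve : ∀ y → ½ * y ≡ y - ½ * y
        halve = solve-∀ ℚ-ring
      0<t-q : 0ℚ < t - q
      0<t-q = *-cancel-0< (<⇒≤ (<-≤-trans 0<κ κ≤)) (<-trans (pos-* 0<M 0<δ) Mδ<)
      δ≤ : δ ≤ t - q
      δ≤ = *-cancelʳ-≤-pos M {{positive 0<M}} (begin
        δ * M             ≡⟨ *-comm δ M ⟩
        M * δ             ≤⟨ <⇒≤ Mδ< ⟩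
        (t - q) * F t q   ≤⟨ *-monoˡ-≤-nonNeg (t - q) {{nonNegative (<⇒≤ 0<t-q)}} (≤-trans (p≤∣p∣ (F t q)) ≤M) ⟩
        (t - q) * M       ∎)
      rearrange : ∀ t q δ → (t - q) - δ ≡ t - (q + δ)
      rearrange = solve-∀ ℚ-ring

-- The discrepancy of prefixes

/1-+ : ∀ i j → (i ℤ.+ j) / 1 ≡ i / 1 + j / 1
/1-+ i j = toℚᵘ-injective (begin
  toℚᵘ ((i ℤ.+ j) / 1)               ≈⟨ toℚᵘ-fromℚᵘ (ℚᵘ.mkℚᵘ (i ℤ.+ j) 0) ⟩
  ℚᵘ.mkℚᵘ (i ℤ.+ j) 0                ≈⟨ ℚᵘ.≃-sym (ℚᵘ.*≡* (clear i j)) ⟩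
  ℚᵘ.mkℚᵘ i 0 ℚᵘ.+ ℚᵘ.mkℚᵘ j 0       ≈⟨ ℚᵘ.+-cong (toℚᵘ-fromℚᵘ (ℚᵘ.mkℚᵘ i 0)) (toℚᵘ-fromℚᵘ (ℚᵘ.mkℚᵘ j 0)) ⟨
  toℚᵘ (i / 1) ℚᵘ.+ toℚᵘ (j / 1)     ≈⟨ toℚᵘ-homo-+ (i / 1) (j / 1) ⟨
  toℚᵘ (i / 1 + j / 1)               ∎)
  where
  open ℚᵘ.≃-Reasoning
  open import Data.Integer.Tactic.RingSolver renaming (solve-∀ to ℤ-solve-∀)
  clear : ∀ i j → (i ℤ.* + 1 ℤ.+ j ℤ.* + 1) ℤ.* + 1 ≡ (i ℤ.+ j) ℤ.* + 1
  clear = ℤ-solve-∀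

nat : ℕ → ℚ
nat n = + n / 1

nat-+ : ∀ m n → nat (m ℕ.+ n) ≡ nat m + nat n
nat-+ m n = /1-+ (+ m) (+ n)

0≤nat : ∀ n → 0ℚ ≤ nat n
0≤nat n = nonNegative⁻¹ (nat n) {{normalize-nonNeg n 1}}

∣*∣≤ : ∀ {p q c d} → ∣ p ∣ ≤ c → ∣ q ∣ ≤ d → ∣ p * q ∣ ≤ c * d
∣*∣≤ {p} {q} {c} {d} p≤c q≤d = begin
  ∣ p * q ∣     ≡⟨ ∣p*q∣≡∣p∣*∣q∣ p q ⟩
  ∣ p ∣ * ∣ q ∣ ≤⟨ *-monoˡ-≤-nonNeg ∣ p ∣ {{∣-∣-nonNeg p}} q≤d ⟩
  ∣ p ∣ * d     ≤⟨ *-monoʳ-≤-nonNeg d {{nonNegative (≤-trans (0≤∣p∣ q) q≤d)}} p≤c ⟩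
  c * d         ∎
  where open ≤-Reasoning

-- The polynomial χ and rational bounds for ψ

-- The factors `1ℚ` reproduce the unfolding of `_^ᵣ_`, so that the hypothesis on ψ speaks of `χ` by
-- computation.
χ : ℚ → ℚ
χ q = q * (q * (q * 1ℚ)) - q * (q * 1ℚ) - q - 1ℚ

χ-slope : ℚ → ℚ → ℚ
χ-slope t q = t * t + t * q + q * q - t - q - 1ℚ

χ-factor : ∀ t q → χ t - χ q ≡ (t - q) * χ-slope t q
χ-factor = unfolded
  where
  unfolded : ∀ t q → (t * (t * (t * 1ℚ)) - t * (t * 1ℚ) - t - 1ℚ)
                   - (q * (q * (q * 1ℚ)) - q * (q * 1ℚ) - q - 1ℚ)
                   ≡ (t - q) * (t * t + t * q + q * q - t - q - 1ℚ)
  unfolded = solve-∀ ℚ-ring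

module _ where
  open ℚ.+-*-Solver

  -- Completes the square in `t` and expands the remaining quadratic in `q` around 11/6, where all
  -- its coefficients are positive. The resulting bound is uniform in `t`.
  χ-slope-square : ∀ t q →
    (t + ½ * (q - 1ℚ)) * (t + ½ * (q - 1ℚ))
      + (+ 1 / 48 + + 9 / 4 * (q - + 11 / 6) + + 3 / 4 * ((q - + 11 / 6) * (q - + 11 / 6)))
    ≡ χ-slope t q - + 1 / 3
  χ-slope-square = solve 2 (λ t q →
    (t :+ con ½ :* (q :- con 1ℚ)) :* (t :+ con ½ :* (q :- con 1ℚ))
      :+ (con (+ 1 / 48) :+ con (+ 9 / 4) :* (q :- con (+ 11 / 6))
      :+ con (+ 3 / 4) :* ((q :- con (+ 11 / 6)) :* (q :- con (+ 11 / 6))))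
    := t :* t :+ t :* q :+ q :* q :- t :- q :- con 1ℚ :- con (+ 1 / 3)) refl

χ-slope-lower : ∀ t {q} → + 11 / 6 ≤ q → + 1 / 3 ≤ χ-slope t q
χ-slope-lower t {q} 11/6≤q = ≤-by
  (0≤p² (t + ½ * (q - 1ℚ)) ⊕ (⟨ + 1 / 48 ⟩ ⊕ ⟨ + 9 / 4 ⟩ ⊗ p≤q⇒0≤q-p 11/6≤q ⊕ ⟨ + 3 / 4 ⟩ ⊗ 0≤p² (q - + 11 / 6)))
  (χ-slope-square t q)

-- 46/25 and 103/56 are consecutive convergents of ψ, and
-- 561/305 = (46 + 5·103)/(25 + 5·56).
ψ⁻ ψ⁺ : ℚ
ψ⁻ = + 103 / 56
ψ⁺ = + 561 / 305

Near : ℚ → Set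
Near q = ψ⁻ ≤ q × q ≤ ψ⁺

-- The slope between any `q` and either endpoint is positive, so the sign of χ(q) - χ(ψ⁻) is that of
-- q - ψ⁻, and likewise at ψ⁺. No prior location of `q` enters.
χ-small⇒near : ∀ {q} → ∣ χ q ∣ < - χ ψ⁻ → ∣ χ q ∣ < χ ψ⁺ → Near q
χ-small⇒near {q} <-χψ⁻ <χψ⁺ = <⇒≤ ψ⁻<q , <⇒≤ q<ψ⁺
  where
  open ≤-Reasoning
  ψ⁻<q : ψ⁻ < q
  ψ⁻<q = 0<q-p⇒p<q (*-cancel-0< {q - ψ⁻} {χ-slope q ψ⁻}
    (≤-trans ⟨ + 1 / 3 ⟩ (χ-slope-lower q (from-yes (+ 11 / 6 ≤? ψ⁻)))) (begin-strict
    0ℚ                        <⟨ p<q⇒0<q-p (≤-<-trans (-p≤∣p∣ (χ q)) <-χψ⁻) ⟩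
    - χ ψ⁻ - - χ q            ≡⟨ swap (χ ψ⁻) (χ q) ⟩
    χ q - χ ψ⁻                ≡⟨ χ-factor q ψ⁻ ⟩
    (q - ψ⁻) * χ-slope q ψ⁻   ∎))
    where
    swap : ∀ x y → - x - - y ≡ y - x
    swap = solve-∀ ℚ-ring
  q<ψ⁺ : q < ψ⁺
  q<ψ⁺ = 0<q-p⇒p<q (*-cancel-0< {ψ⁺ - q} {χ-slope q ψ⁺}
    (≤-trans ⟨ + 1 / 3 ⟩ (χ-slope-lower q (from-yes (+ 11 / 6 ≤? ψ⁺)))) (begin-strict
    0ℚ                        <⟨ p<q⇒0<q-p (≤-<-trans (p≤∣p∣ (χ q)) <χψ⁺) ⟩
    χ ψ⁺ - χ q                ≡⟨ χ-factor ψ⁺ q ⟩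
    (ψ⁺ - q) * χ-slope ψ⁺ q   ≡⟨ cong ((ψ⁺ - q) *_) (χ-slope-comm ψ⁺ q) ⟩
    (ψ⁺ - q) * χ-slope q ψ⁺   ∎))
    where
    χ-slope-comm : ∀ s t → s * s + s * t + t * t - s - t - 1ℚ ≡ t * t + t * s + s * s - t - s - 1ℚ
    χ-slope-comm = solve-∀ ℚ-ring

Δ : ℚ → Word → ℚ
Δ q w = nat (# 1F w) + (1ℚ - q) * nat (# 0F w)

Δ-++ : ∀ q u v → Δ q (u ++ v) ≡ Δ q u + Δ q v
Δ-++ q u v = trans
  (cong₂ (λ m n → m + (1ℚ - q) * n)
    (trans (cong nat (#-++ 1F u v)) (nat-+ (# 1F u) (# 1F v)))
    (trans (cong nat (#-++ 0F u v)) (nat-+ (# 0F u) (# 0F v))))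
  (regroup (nat (# 1F u)) (nat (# 1F v)) (nat (# 0F u)) (nat (# 0F v)) q)
  where
  regroup : ∀ x y z w q → (x + y) + (1ℚ - q) * (z + w) ≡ (x + (1ℚ - q) * z) + (y + (1ℚ - q) * w)
  regroup = solve-∀ ℚ-ring

Δ-antitone : ∀ w {p q} → p ≤ q → Δ q w ≤ Δ p w
Δ-antitone w {p} {q} p≤q = ≤-by (p≤q⇒0≤q-p p≤q ⊗ 0≤nat (# 0F w)) (regroup (nat (# 1F w)) (nat (# 0F w)) p q)
  where
  regroup : ∀ x z p q → (q - p) * z ≡ (x + (1ℚ - p) * z) - (x + (1ℚ - q) * z)
  regroup = solve-∀ ℚ-ring

-- Reduces a bound for all `q` near ψ to two evaluations at rational endpoints.
Δ-within : ∀ w {q} → Near q → Δ ψ⁺ w ≤ Δ q w × Δ q w ≤ Δ ψ⁻ w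
Δ-within w (ψ⁻≤q , q≤ψ⁺) = Δ-antitone w q≤ψ⁺ , Δ-antitone w ψ⁻≤q

-- Decay of the discrepancy of `T k`

ΔT : ℚ → ℕ → ℚ
ΔT q k = Δ q (T k)

ΔT-rec : ∀ q k → ΔT q (3 ℕ.+ k) ≡ ΔT q (2 ℕ.+ k) + (ΔT q (1 ℕ.+ k) + ΔT q k)
ΔT-rec q k = trans
  (Δ-++ q (T (2 ℕ.+ k)) (T (1 ℕ.+ k) ++ T k))
  (cong (λ z → ΔT q (2 ℕ.+ k) + z) (Δ-++ q (T (1 ℕ.+ k)) (T k)))

-- X³ - X² - X - 1 = (X - ψ)(X² + (ψ - 1)X + (ψ² - ψ - 1)), so the residual
-- vanishes for q = ψ.
residual : ℚ → ℕ → ℚ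
residual q k = ΔT q (2 ℕ.+ k) + (q - 1ℚ) * ΔT q (1 ℕ.+ k) + (q * q - q - 1ℚ) * ΔT q k

-- The initial values 1, 2 - q, 3 - 2q make the residual vanish identically in `q`.
residual-zero : ∀ q → residual q 0 ≡ 0ℚ
residual-zero = unfolded
  where
  unfolded : ∀ q → (1ℚ + (1ℚ - q) * (1ℚ + 1ℚ)) + (q - 1ℚ) * (1ℚ + (1ℚ - q) * 1ℚ)
                     + (q * q - q - 1ℚ) * (1ℚ + (1ℚ - q) * 0ℚ) ≡ 0ℚ
  unfolded = solve-∀ ℚ-ring

-- The residual is an eigenfunctional of the recurrence with eigenvalue ψ; an approximation `q`
-- leaves a multiple of `χ q`.
residual-suc : ∀ q k → residual q (suc k) ≡ q * residual q k + (- ΔT q k) * χ q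
residual-suc q k = trans
  (cong (λ z → z + (q - 1ℚ) * ΔT q (2 ℕ.+ k) + (q * q - q - 1ℚ) * ΔT q (1 ℕ.+ k)) (ΔT-rec q k))
  (regroup q (ΔT q k) (ΔT q (1 ℕ.+ k)) (ΔT q (2 ℕ.+ k)))
  where
  regroup : ∀ q x y z → (z + (y + x)) + (q - 1ℚ) * z + (q * q - q - 1ℚ) * y
          ≡ q * (z + (q - 1ℚ) * y + (q * q - q - 1ℚ) * x)
            + (- x) * (q * (q * (q * 1ℚ)) - q * (q * 1ℚ) - q - 1ℚ)
  regroup = solve-∀ ℚ-ring

-- Over three steps the coefficients 2 - ψ and (2 - ψ)(1 + ψ) have sum 0.617…
ΔT-contract : ∀ q k → ΔT q (3 ℕ.+ k) ≡ (1ℚ + 1ℚ - q) * (ΔT q (1 ℕ.+ k) + (1ℚ + q) * ΔT q k) + residual q k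
ΔT-contract q k = trans (ΔT-rec q k) (regroup q (ΔT q k) (ΔT q (1 ℕ.+ k)) (ΔT q (2 ℕ.+ k)))
  where
  regroup : ∀ q x y z → z + (y + x)
          ≡ (1ℚ + 1ℚ - q) * (y + (1ℚ + q) * x) + (z + (q - 1ℚ) * y + (q * q - q - 1ℚ) * x)
  regroup = solve-∀ ℚ-ring

-- The ratio lies above ψ^(-1/2) = 0.737…, the modulus of the small eigenvalues.
β : ℕ → ℚ
β zero    = + 1 / 14
β (suc k) = + 6 / 7 * β k

0<β : ∀ k → 0ℚ < β k
0<β zero    = positive⁻¹ (+ 1 / 14)
0<β (suc k) = pos-* (positive⁻¹ (+ 6 / 7)) (0<β k)

-- With 2 - q at most 1/6 and 1 + q at most 20/7, three steps contract by 13/21, while β allows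
-- (6/7)³ = 216/343. The gap 11/1029 is the allowance for the residual.
β-sum : ∀ y → + 1 / 6 * (+ 6 / 7 * y + + 20 / 7 * y) + + 11 / 1029 * y ≡ + 6 / 7 * (+ 6 / 7 * (+ 6 / 7 * y))
β-sum = solve 1 (λ y →
  con (+ 1 / 6) :* (con (+ 6 / 7) :* y :+ con (+ 20 / 7) :* y) :+ con (+ 11 / 1029) :* y :=
  con (+ 6 / 7) :* (con (+ 6 / 7) :* (con (+ 6 / 7) :* y))) refl
  where open ℚ.+-*-Solver

ΔT-step : ∀ j k {q} → Near q → ∣ residual q j ∣ < + 11 / 1029 * β k →
         ∣ ΔT q j ∣ ≤ β k → ∣ ΔT q (1 ℕ.+ j) ∣ ≤ β (1 ℕ.+ k) →
         ∣ ΔT q (3 ℕ.+ j) ∣ ≤ β (3 ℕ.+ k)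
ΔT-step j k {q} (ψ⁻≤q , q≤ψ⁺) res< e≤ e′≤ = begin
  ∣ ΔT q (3 ℕ.+ j) ∣
    ≡⟨ cong ∣_∣ (ΔT-contract q j) ⟩
  ∣ c * (ΔT q (1 ℕ.+ j) + d * ΔT q j) + residual q j ∣
    ≤⟨ ∣p+q∣≤∣p∣+∣q∣ (c * (ΔT q (1 ℕ.+ j) + d * ΔT q j)) (residual q j) ⟩
  ∣ c * (ΔT q (1 ℕ.+ j) + d * ΔT q j) ∣ + ∣ residual q j ∣
    ≤⟨ +-mono-≤ (∣*∣≤ {c} {ΔT q (1 ℕ.+ j) + d * ΔT q j} c≤ (begin
         ∣ ΔT q (1 ℕ.+ j) + d * ΔT q j ∣       ≤⟨ ∣p+q∣≤∣p∣+∣q∣ (ΔT q (1 ℕ.+ j)) (d * ΔT q j) ⟩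
         ∣ ΔT q (1 ℕ.+ j) ∣ + ∣ d * ΔT q j ∣   ≤⟨ +-mono-≤ e′≤ (∣*∣≤ {d} {ΔT q j} d≤ e≤) ⟩
         β (1 ℕ.+ k) + + 20 / 7 * β k        ∎)) (<⇒≤ res<) ⟩
  + 1 / 6 * (+ 6 / 7 * β k + + 20 / 7 * β k) + + 11 / 1029 * β k
    ≡⟨ β-sum (β k) ⟩
  β (3 ℕ.+ k) ∎
  where
  open ≤-Reasoning
  c d : ℚ
  c = 1ℚ + 1ℚ - q
  d = 1ℚ + q
  c≤ : ∣ c ∣ ≤ + 1 / 6
  c≤ = ∣p∣≤q (≤-trans (from-yes (- (+ 1 / 6) ≤? 1ℚ + 1ℚ - ψ⁺)) (+-monoʳ-≤ (1ℚ + 1ℚ) (neg-antimono-≤ q≤ψ⁺)))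
             (≤-trans (+-monoʳ-≤ (1ℚ + 1ℚ) (neg-antimono-≤ ψ⁻≤q)) (from-yes (1ℚ + 1ℚ - ψ⁻ ≤? + 1 / 6)))
  d≤ : ∣ d ∣ ≤ + 20 / 7
  d≤ = ∣p∣≤q (≤-trans (from-yes (- (+ 20 / 7) ≤? 1ℚ + ψ⁻)) (+-monoʳ-≤ 1ℚ ψ⁻≤q))
             (≤-trans (+-monoʳ-≤ 1ℚ q≤ψ⁺) (from-yes (1ℚ + ψ⁺ ≤? + 20 / 7)))

-- Discrepancy of the prefixes of `T k` and of `𝐁`

take-length-++ : ∀ (u v : Word) → take (length u) (u ++ v) ≡ u
take-length-++ []      v = refl
take-length-++ (x ∷ u) v = cong (x ∷_) (take-length-++ u v)

-- Used with y = 7 β k = β k + β (1 + k) + …, the room needed for the later steps.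
Within : ℚ → ℚ → Word → Set
Within q y u = - (+ 8 / 5) + y ≤ Δ q u × Δ q u ≤ + 12 / 5 - y

within-T₁₀ : ∀ {q} → Near q → ∀ u → u ≼ T 10 → Within q (+ 7 / 1 * β 0) u
within-T₁₀ near u (v , eq) =
  let lower , upper = Δ-within u near
      ψ⁺≤ , ≤ψ⁻ = subst AtEndpoints u≡ (check ∣u∣<424)
  in ≤-trans ψ⁺≤ lower , ≤-trans upper ≤ψ⁻
  where
  low high : ℚ
  low  = - (+ 8 / 5) + + 7 / 1 * β 0
  high = + 12 / 5 - + 7 / 1 * β 0
  AtEndpoints : Word → Set
  AtEndpoints w = low ≤ Δ ψ⁺ w × Δ ψ⁻ w ≤ high
  -- `T 10` has length 423, so its 424 prefixes, including the empty and the full one, are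
  -- evaluated.
  check : ∀ {p} → p ℕ.< 424 → AtEndpoints (take p (T 10))
  check = from-yes (ℕ.allUpTo?
    (λ p → (low ≤? Δ ψ⁺ (take p (T 10))) ×-dec (Δ ψ⁻ (take p (T 10)) ≤? high)) 424)
  u≡ : take (length u) (T 10) ≡ u
  u≡ = trans (cong (take (length u)) (sym eq)) (take-length-++ u v)
  ∣u∣<424 : length u ℕ.< 424
  ∣u∣<424 = ℕ.s≤s (subst (length u ℕ.≤_)
    (trans (sym (length-++ u {v})) (cong length {u ++ v} {T 10} eq))
    (ℕ.m≤m+n (length u) (length v)))

ΔT-base : ∀ k c → - c ≤ Δ ψ⁺ (T k) → Δ ψ⁻ (T k) ≤ c → ∀ {q} → Near q → ∣ ΔT q k ∣ ≤ c
ΔT-base k c -c≤ ≤c near =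
  let lower , upper = Δ-within (T k) near in ∣p∣≤q (≤-trans -c≤ lower) (≤-trans upper ≤c)

ΔT₁₀ : ∀ {q} → Near q → ∣ ΔT q 10 ∣ ≤ β 0
ΔT₁₀ = ΔT-base 10 (β 0) (from-yes (- β 0 ≤? Δ ψ⁺ (T 10))) (from-yes (Δ ψ⁻ (T 10) ≤? β 0))

ΔT₁₁ : ∀ {q} → Near q → ∣ ΔT q 11 ∣ ≤ β 1
ΔT₁₁ = ΔT-base 11 (β 1) (from-yes (- β 1 ≤? Δ ψ⁺ (T 11))) (from-yes (Δ ψ⁻ (T 11) ≤? β 1))

ΔT₁₂ : ∀ {q} → Near q → ∣ ΔT q 12 ∣ ≤ β 2
ΔT₁₂ = ΔT-base 12 (β 2) (from-yes (- β 2 ≤? Δ ψ⁺ (T 12))) (from-yes (Δ ψ⁻ (T 12) ≤? β 2))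

-- A prefix that extends beyond `T (10 + k)` changes Δ by at most `β k`, which is exactly what the
-- reserve 7β loses from `k` to `1 + k`.
within-step : ∀ k {q} → ∣ ΔT q (10 ℕ.+ k) ∣ ≤ β k →
              (∀ u → u ≼ T (10 ℕ.+ k) → Within q (+ 7 / 1 * β k) u) →
              ∀ u → u ≼ T (11 ℕ.+ k) → Within q (+ 7 / 1 * β (1 ℕ.+ k)) u
within-step k {q} e≤ ih u u≼ =
  subst (λ y → Within q y u) (sym (seven (β k))) (by-cases (≼-++ (T (10 ℕ.+ k)) u≼))
  where
  z = + 7 / 1 * β k
  seven : ∀ y → + 7 / 1 * (+ 6 / 7 * y) ≡ + 7 / 1 * y - y
  seven = solve 1 (λ y → con (+ 7 / 1) :* (con (+ 6 / 7) :* y) := con (+ 7 / 1) :* y :- y) refl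
    where open ℚ.+-*-Solver
  by-cases : u ≼ T (10 ℕ.+ k) ⊎
             ∃[ u′ ] (u ≡ T (10 ℕ.+ k) ++ u′ × u′ ≼ T (9 ℕ.+ k) ++ T (8 ℕ.+ k)) →
             Within q (z - β k) u
  by-cases (inj₁ u≼′) =
    let lower , upper = ih u u≼′ in
    ≤-trans (≤-by (<⇒≤ (0<β k)) (below (- (+ 8 / 5)) z (β k))) lower ,
    ≤-trans upper (≤-by (<⇒≤ (0<β k)) (above (+ 12 / 5) z (β k)))
    where
    below : ∀ c z y → y ≡ (c + z) - (c + (z - y))
    below = solve-∀ ℚ-ring
    above : ∀ c z y → y ≡ (c - (z - y)) - (c - z)
    above = solve-∀ ℚ-ring
  by-cases (inj₂ (u′ , u≡ , u′≼)) =
    -- The rest `u′` is a prefix of `T (9 + k) ++ T (8 + k)`, hence again of `T (10 + k)`.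
    let lower , upper = ih u′ (≼-trans u′≼ (T-tail (7 ℕ.+ k)))
        Δu≡ = trans (cong (Δ q) u≡) (Δ-++ q (T (10 ℕ.+ k)) u′)
    in (begin
         - (+ 8 / 5) + (z - β k)        ≡⟨ below (- (+ 8 / 5)) z (β k) ⟩
         - β k + (- (+ 8 / 5) + z)      ≤⟨ +-mono-≤
                                             (≤-trans (neg-antimono-≤ e≤) (-∣p∣≤p (ΔT q (10 ℕ.+ k))))
                                             lower ⟩
         ΔT q (10 ℕ.+ k) + Δ q u′        ≡⟨ Δu≡ ⟨
         Δ q u                          ∎) ,
       (begin
         Δ q u                          ≡⟨ Δu≡ ⟩
         ΔT q (10 ℕ.+ k) + Δ q u′        ≤⟨ +-mono-≤ (≤-trans (p≤∣p∣ (ΔT q (10 ℕ.+ k))) e≤) upper ⟩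
         β k + (+ 12 / 5 - z)           ≡⟨ above (+ 12 / 5) z (β k) ⟩
         + 12 / 5 - (z - β k)           ∎)
    where
    open ≤-Reasoning
    below : ∀ c z y → c + (z - y) ≡ - y + (c + z)
    below = solve-∀ ℚ-ring
    above : ∀ c z y → y + (c - z) ≡ c - (z - y)
    above = solve-∀ ℚ-ring

negligible-resp : ∀ x {f μ} → (∀ q → f q ≡ μ q) → Negligible x f → Negligible x μ
negligible-resp x f≗g nf ε 0<ε = eventually (λ {q} → subst (λ y → ∣ y ∣ < ε) (f≗g q)) (nf ε 0<ε)

-- For a prefix of length p with n zeros this yields p - 2 < ψn < p + 3. With n ones instead,
-- division by ψ - 1 = 0.839... yields p - 3 < γn < p + 2.
Balanced : ℕ → ℚ → Set
Balanced k q = - (+ 5 / 2) ≤ Δ q w × Δ q w ≤ + 8 / 5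
  where w = applyUpTo 𝐁 (suc k)

-- The leading 0 of `𝐁` shifts the interval from -8/5 to 12/5 by 1 - q, about -0.839.
within⇒balanced : ∀ k {q} → Near q →
  (∀ u → u ≼ T (11 ℕ.+ k) → Within q (+ 7 / 1 * β (suc k)) u) → Balanced k q
within⇒balanced k {q} (ψ⁻≤q , q≤ψ⁺) within =
  let lower , upper = within u u≼
  in (begin
       - (+ 5 / 2)                        ≤⟨ from-yes (- (+ 5 / 2) ≤? (1ℚ - ψ⁺) + (- (+ 8 / 5) + 0ℚ)) ⟩
       (1ℚ - ψ⁺) + (- (+ 8 / 5) + 0ℚ)      ≤⟨ +-mono-≤
                                               (+-monoʳ-≤ 1ℚ (neg-antimono-≤ q≤ψ⁺))
                                               (≤-trans (+-monoʳ-≤ (- (+ 8 / 5)) 0≤7β) lower) ⟩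
       (1ℚ - q) + Δ q u                   ≡⟨ Δw≡ ⟨
       Δ q (0F ∷ u)                       ∎) ,
     (begin
       Δ q (0F ∷ u)                       ≡⟨ Δw≡ ⟩
       (1ℚ - q) + Δ q u                   ≤⟨ +-mono-≤
                                               (+-monoʳ-≤ 1ℚ (neg-antimono-≤ ψ⁻≤q))
                                               (≤-trans upper (+-monoʳ-≤ (+ 12 / 5) (neg-antimono-≤ 0≤7β))) ⟩
       (1ℚ - ψ⁻) + (+ 12 / 5 - 0ℚ)         ≤⟨ from-yes ((1ℚ - ψ⁻) + (+ 12 / 5 - 0ℚ) ≤? + 8 / 5) ⟩
       + 8 / 5                            ∎)
  where
  open ≤-Reasoning
  u = applyUpTo (λ i → 𝐁 (suc i)) k
  u≼ : u ≼ T (11 ℕ.+ k)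
  -- The index `3 + (7 + suc k)` computes to `11 + k`.
  u≼ = let v , eq = 𝐁≼T 7 (suc k) in v , proj₂ (∷-injective eq)
  0≤7β : 0ℚ ≤ + 7 / 1 * β (suc k)
  0≤7β = ⟨ + 7 / 1 ⟩ ⊗ <⇒≤ (0<β (suc k))
  Δw≡ : Δ q (0F ∷ u) ≡ (1ℚ - q) + Δ q u
  Δw≡ = trans (Δ-++ q (0F ∷ []) u) (one q (Δ q u))
    where
    one : ∀ q y → 0ℚ + (1ℚ - q) * 1ℚ + y ≡ (1ℚ - q) + y
    one = solve-∀ ℚ-ring

-- Bounds for almost all terms of ψ

module _ (ψ : ℝ) (root : ψ ^ᵣ 3 -ᵣ ψ ^ᵣ 2 -ᵣ ψ -ᵣ fromℕ 1 ≃ᵣ fromℕ 0) where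

  χ-negligible : Negligible ψ χ
  χ-negligible ε 0<ε =
    eventually (λ {q} → subst (λ y → ∣ y ∣ < ε) (+-identityʳ (χ q))) (mkEventually (root ε 0<ε))

  near : Eventually ψ Near
  near = eventually (λ (<-χψ⁻ , <χψ⁺) → χ-small⇒near <-χψ⁻ <χψ⁺)
    (χ-negligible (- χ ψ⁻) (from-yes (0ℚ <? - χ ψ⁻)) ∧ χ-negligible (χ ψ⁺) (from-yes (0ℚ <? χ ψ⁺)))

  residual-negligible : ∀ k → Negligible ψ (λ q → residual q k)
  residual-negligible zero ε 0<ε = mkEventually
    (0 , λ n _ → subst (λ y → ∣ y ∣ < ε) (sym (residual-zero (seq ψ n))) 0<ε)
  residual-negligible (suc k) = negligible-resp ψ (λ q → sym (residual-suc q k))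
    (negligible-+ ψ {λ q → q * residual q k} {λ q → (- ΔT q k) * χ q}
      (negligible-* ψ {λ q → q} {λ q → residual q k} (bounded ψ ψ (λ _ → refl)) (residual-negligible k))
      (negligible-* ψ {λ q → - ΔT q k} {χ}
        (bounded ψ (-ᵣ (fromℕ (# 1F (T k)) +ᵣ (fromℕ 1 -ᵣ ψ) *ᵣ fromℕ (# 0F (T k)))) (λ _ → refl))
        χ-negligible))

  -- The index from which the bound holds may depend on `k`; a given prefix of `𝐁` uses finitely
  -- many `k`, so these indices have a maximum.
  ΔT-decay : ∀ k → Eventually ψ (λ q → ∣ ΔT q (10 ℕ.+ k) ∣ ≤ β k)
  ΔT-decay 0 = eventually ΔT₁₀ near
  ΔT-decay 1 = eventually ΔT₁₁ near
  ΔT-decay 2 = eventually ΔT₁₂ near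
  ΔT-decay (suc (suc (suc k))) = eventually
    (λ (near , res< , e≤ , e′≤) → ΔT-step (10 ℕ.+ k) k near res< e≤ e′≤)
    (near ∧ residual-negligible (10 ℕ.+ k) (+ 11 / 1029 * β k)
                                (pos-* (positive⁻¹ (+ 11 / 1029)) (0<β k))
          ∧ ΔT-decay k ∧ ΔT-decay (suc k))

  within : ∀ k → Eventually ψ (λ q → ∀ u → u ≼ T (10 ℕ.+ k) → Within q (+ 7 / 1 * β k) u)
  within zero    = eventually within-T₁₀ near
  within (suc k) = eventually (λ {q} (e≤ , ih) → within-step k {q} e≤ ih) (ΔT-decay k ∧ within k)

  balanced : ∀ k → Eventually ψ (Balanced k)
  balanced k = eventually (λ {q} (near , within) → within⇒balanced k {q} near within) (near ∧ within (suc k))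

-- Floors

-- Tests `l + 1`, `l + 2`, ... in turn until one exceeds `x`; its predecessor is the floor.
floor-between : ∀ x → (∀ i → fromℤ i ≤ᵣ x ⊎ x <ᵣ fromℤ i) →
                ∀ d l → fromℤ l ≤ᵣ x → x <ᵣ fromℤ (l ℤ.+ + suc d) →
                ∃[ m ] (⌊ x ⌋≡ m × l ℤ.≤ m × m ℤ.≤ l ℤ.+ + d)
floor-between x compare zero l l≤x x<l+1 =
  l , (l≤x , x<l+1) , ℤ.≤-refl , ℤ.≤-reflexive (sym (ℤ.+-identityʳ l))
floor-between x compare (suc d) l l≤x x< with compare (l ℤ.+ + 1)
... | inj₂ x<l+1 = l , (l≤x , x<l+1) , ℤ.≤-refl , ℤ.i≤i+j l (+ suc d)
... | inj₁ l+1≤x =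
  let m , ⌊x⌋≡m , l+1≤m , m≤ = floor-between x compare d (l ℤ.+ + 1) l+1≤x
                                 (subst (λ i → x <ᵣ fromℤ i) (sym (ℤ.+-assoc l (+ 1) (+ suc d))) x<)
  in m , ⌊x⌋≡m , ℤ.≤-trans (ℤ.i≤i+j l (+ 1)) l+1≤m , subst (m ℤ.≤_) (ℤ.+-assoc l (+ 1) (+ d)) m≤

-- Comparing the multiple with `i` amounts to comparing `x` with i/n; `δ` below is 1/n.
compare-multiple : ∀ x → (∀ t → fromℚ t ≤ᵣ x ⊎ x <ᵣ fromℚ t) →
                   ∀ n → n ℕ.≥ 1 → ∀ i → fromℤ i ≤ᵣ x *ᵣ fromℕ n ⊎ x *ᵣ fromℕ n <ᵣ fromℤ i
compare-multiple x compare n@(suc _) _ i = scale (compare (δ * (i / 1)))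
  where
  open ≤-Reasoning
  0<n : 0ℚ < nat n
  0<n = positive⁻¹ (nat n) {{normalize-pos n 1}}
  δ : ℚ
  δ = proj₁ (divide (positive⁻¹ 1ℚ) 0<n)
  0<δ : 0ℚ < δ
  0<δ = proj₁ (proj₂ (divide (positive⁻¹ 1ℚ) 0<n))
  nδ≡1 : nat n * δ ≡ 1ℚ
  nδ≡1 = proj₂ (proj₂ (divide (positive⁻¹ 1ℚ) 0<n))
  unscale : ∀ y → δ * y * nat n ≡ y
  unscale y = trans (regroup δ y (nat n)) (trans (cong (_* y) nδ≡1) (*-identityˡ y))
    where
    regroup : ∀ d y n → d * y * n ≡ n * d * y
    regroup = solve-∀ ℚ-ring
  scale : fromℚ (δ * (i / 1)) ≤ᵣ x ⊎ x <ᵣ fromℚ (δ * (i / 1)) →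
          fromℤ i ≤ᵣ x *ᵣ fromℕ n ⊎ x *ᵣ fromℕ n <ᵣ fromℤ i
  scale (inj₁ t≤x) = inj₁ λ ε 0<ε →
    let N , t≤ = t≤x (δ * ε) (pos-* 0<δ 0<ε) in
    N , λ k N≤k → begin
      i / 1                               ≡⟨ unscale (i / 1) ⟨
      δ * (i / 1) * nat n                 ≤⟨ *-monoʳ-≤-nonNeg (nat n) {{nonNegative (<⇒≤ 0<n)}} (t≤ k N≤k) ⟩
      (seq x k + δ * ε) * nat n           ≡⟨ *-distribʳ-+ (nat n) (seq x k) (δ * ε) ⟩
      seq x k * nat n + δ * ε * nat n     ≡⟨ cong (λ y → seq x k * nat n + y) (unscale ε) ⟩
      seq x k * nat n + ε                 ∎
  scale (inj₂ (ε , 0<ε , N , ≤t)) = inj₂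
    (ε * nat n , pos-* 0<ε 0<n , N , λ k N≤k → begin
      seq x k * nat n + ε * nat n         ≡⟨ *-distribʳ-+ (nat n) (seq x k) ε ⟨
      (seq x k + ε) * nat n               ≤⟨ *-monoʳ-≤-nonNeg (nat n) {{nonNegative (<⇒≤ 0<n)}} (≤t k N≤k) ⟩
      δ * (i / 1) * nat n                 ≡⟨ unscale (i / 1) ⟩
      i / 1                               ∎)

-- The number γ

γ-of : ℚ → ℚ
γ-of q = (q * (q * 1ℚ) + 1ℚ) * ½

-- 2μ is the minimal polynomial 2X³ - 6X² + 4X - 1 of γ.
μ : ℚ → ℚ
μ y = y * y * y - (1ℚ + 1ℚ + 1ℚ) * (y * y) + (1ℚ + 1ℚ) * y - ½

μ-slope : ℚ → ℚ → ℚ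
μ-slope t y = t * t + t * y + y * y - (1ℚ + 1ℚ + 1ℚ) * (t + y) + (1ℚ + 1ℚ)

μ-factor : ∀ t y → μ t - μ y ≡ (t - y) * μ-slope t y
μ-factor = unfolded
  where
  unfolded : ∀ t y → (t * t * t - (1ℚ + 1ℚ + 1ℚ) * (t * t) + (1ℚ + 1ℚ) * t - ½)
                   - (y * y * y - (1ℚ + 1ℚ + 1ℚ) * (y * y) + (1ℚ + 1ℚ) * y - ½)
                   ≡ (t - y) * (t * t + t * y + y * y - (1ℚ + 1ℚ + 1ℚ) * (t + y) + (1ℚ + 1ℚ))
  unfolded = solve-∀ ℚ-ring

μ-cofactor : ℚ → ℚ
μ-cofactor q = (q * q * q + q * q - q + 1ℚ) * (½ * ½ * ½)

-- The cofactor is -χ(-q)/8: since γ depends on q², the composite of μ and `γ-of` is even in `q`.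
μ-γ : ∀ q → μ-cofactor q * χ q ≡ μ (γ-of q)
μ-γ = unfolded
  where
  unfolded : ∀ q → (q * q * q + q * q - q + 1ℚ) * (½ * ½ * ½)
      * (q * (q * (q * 1ℚ)) - q * (q * 1ℚ) - q - 1ℚ)
    ≡ (q * (q * 1ℚ) + 1ℚ) * ½ * ((q * (q * 1ℚ) + 1ℚ) * ½) * ((q * (q * 1ℚ) + 1ℚ) * ½)
      - (1ℚ + 1ℚ + 1ℚ) * ((q * (q * 1ℚ) + 1ℚ) * ½ * ((q * (q * 1ℚ) + 1ℚ) * ½))
      + (1ℚ + 1ℚ) * ((q * (q * 1ℚ) + 1ℚ) * ½) - ½
  unfolded = solve-∀ ℚ-ring

γ-lower : ∀ {q} → Near q → + 219 / 100 ≤ γ-of q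
γ-lower {q} (ψ⁻≤q , _) = ≤-trans (from-yes (+ 219 / 100 ≤? γ-of ψ⁻))
  (≤-by (p≤q⇒0≤q-p ψ⁻≤q ⊗ (≤-trans ⟨ ψ⁻ ⟩ ψ⁻≤q ⊕ ⟨ ψ⁻ ⟩) ⊗ ⟨ ½ ⟩) (difference ψ⁻ q))
  where
  difference : ∀ s q → (q - s) * (q + s) * ½ ≡ (q * (q * 1ℚ) + 1ℚ) * ½ - (s * (s * 1ℚ) + 1ℚ) * ½
  difference = solve-∀ ℚ-ring

module _ where
  open ℚ.+-*-Solver

  -- Again a completed square in `t`. The quadratic left in `y`, before 1/20 is subtracted, has its
  -- larger root near 2.155, so it is expanded around 219/100, just below γ.
  μ-slope-square : ∀ t y →
    (t + ½ * (y - + 3 / 1)) * (t + ½ * (y - + 3 / 1))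
      + (+ 3 / 4 * ((y - + 219 / 100) * (y - + 219 / 100)) + + 357 / 200 * (y - + 219 / 100) + + 483 / 40000)
    ≡ μ-slope t y - + 1 / 20
  μ-slope-square = solve 2 (λ t y →
    (t :+ con ½ :* (y :- con (+ 3 / 1))) :* (t :+ con ½ :* (y :- con (+ 3 / 1)))
      :+ (con (+ 3 / 4) :* ((y :- con (+ 219 / 100)) :* (y :- con (+ 219 / 100)))
      :+ con (+ 357 / 200) :* (y :- con (+ 219 / 100)) :+ con (+ 483 / 40000))
    := t :* t :+ t :* y :+ y :* y
      :- con (1ℚ + 1ℚ + 1ℚ) :* (t :+ y) :+ con (1ℚ + 1ℚ) :- con (+ 1 / 20)) refl

μ-slope-lower : ∀ t {y} → + 219 / 100 ≤ y → + 1 / 20 ≤ μ-slope t y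
μ-slope-lower t {y} ≤y = ≤-by
  (0≤p² (t + ½ * (y - + 3 / 1)) ⊕
    (⟨ + 3 / 4 ⟩ ⊗ 0≤p² (y - + 219 / 100) ⊕ ⟨ + 357 / 200 ⟩ ⊗ p≤q⇒0≤q-p ≤y ⊕ ⟨ + 483 / 40000 ⟩))
  (μ-slope-square t y)

-- The identities for γ come from γ(ψ - 1) = ψ, that is
-- γ-of q * (q - 1) = q + ½ χ(q); s stands for the lower bound ψ⁻ of q.
module _ where
  open ℚ.+-*-Solver

  -- The slack is 2 - 8/5 = 2/5; in the upper identity it is 3 - 5/2 = ½, which makes that bound
  -- strict.
  ψ-lower-identity : ∀ n m q ε →
    (+ 8 / 5 - (m + (1ℚ - q) * n)) + (+ 2 / 5 + ε) ≡ (q * n + ε) - (n + m + - (+ 2 / 1))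
  ψ-lower-identity = solve 4 (λ n m q ε →
    (con (+ 8 / 5) :- (m :+ (con 1ℚ :- q) :* n)) :+ (con (+ 2 / 5) :+ ε)
    := (q :* n :+ ε) :- (n :+ m :+ :- con (+ 2 / 1))) refl

  ψ-upper-identity : ∀ n m q →
    (m + (1ℚ - q) * n) - - (+ 5 / 2) ≡ (n + m + - (+ 2 / 1) + + 5 / 1) - (q * n + ½)
  ψ-upper-identity = solve 3 (λ n m q →
    (m :+ (con 1ℚ :- q) :* n) :- :- con (+ 5 / 2)
    := (n :+ m :+ :- con (+ 2 / 1) :+ con (+ 5 / 1)) :- (q :* n :+ con ½)) refl

  γ-lower-identity : ∀ n m q s →
    ((m + (1ℚ - q) * n) - - (+ 5 / 2))
      + (½ * m * (q * (q * (q * 1ℚ)) - q * (q * 1ℚ) - q - 1ℚ) - - (+ 1 / 100))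
      -- 251/100 is 5/2 plus 1/100 for the error ½ m χ(q); it stays below 3(ψ⁻ - 1).
      + (+ 3 / 1 * (q - s) + (+ 3 / 1 * (s - 1ℚ) - + 251 / 100))
    ≡ ((q * (q * 1ℚ) + 1ℚ) * ½ * m - (n + m + - (+ 3 / 1))) * (q - 1ℚ)
  γ-lower-identity = solve 4 (λ n m q s →
    ((m :+ (con 1ℚ :- q) :* n) :- :- con (+ 5 / 2))
      :+ (con ½ :* m :* (q :* (q :* (q :* con 1ℚ)) :- q :* (q :* con 1ℚ) :- q :- con 1ℚ) :- :- con (+ 1 / 100))
      :+ (con (+ 3 / 1) :* (q :- s) :+ (con (+ 3 / 1) :* (s :- con 1ℚ) :- con (+ 251 / 100)))
    := ((q :* (q :* con 1ℚ) :+ con 1ℚ) :* con ½ :* m :- (n :+ m :+ :- con (+ 3 / 1))) :* (q :- con 1ℚ)) refl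

  γ-upper-identity : ∀ n m q s →
    (+ 8 / 5 - (m + (1ℚ - q) * n))
      + (+ 1 / 100 - ½ * m * (q * (q * (q * 1ℚ)) - q * (q * 1ℚ) - q - 1ℚ))
      -- 199/100 is 2 minus the strict margin 1/100, and 161/100 is 8/5 plus the error allowance
      -- 1/100.
      + (+ 199 / 100 * (q - s) + (+ 199 / 100 * (s - 1ℚ) - + 161 / 100))
    ≡ ((n + m + - (+ 3 / 1) + + 5 / 1) - ((q * (q * 1ℚ) + 1ℚ) * ½ * m + + 1 / 100)) * (q - 1ℚ)
  γ-upper-identity = solve 4 (λ n m q s →
    (con (+ 8 / 5) :- (m :+ (con 1ℚ :- q) :* n))
      :+ (con (+ 1 / 100) :- con ½ :* m :* (q :* (q :* (q :* con 1ℚ)) :- q :* (q :* con 1ℚ) :- q :- con 1ℚ))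
      :+ (con (+ 199 / 100) :* (q :- s) :+ (con (+ 199 / 100) :* (s :- con 1ℚ) :- con (+ 161 / 100)))
    := ((n :+ m :+ :- con (+ 3 / 1) :+ con (+ 5 / 1))
       :- ((q :* (q :* con 1ℚ) :+ con 1ℚ) :* con ½ :* m :+ con (+ 1 / 100))) :* (q :- con 1ℚ)) refl

-- Positions compared with ψn and γn

position : ∀ k → nat (suc k) ≡ nat (#occurrences 0F (suc k)) + nat (#occurrences 1F (suc k))
position k = trans
  (cong nat (sym (trans (#0+#1≡length (applyUpTo 𝐁 (suc k))) (length-applyUpTo 𝐁 (suc k)))))
  (nat-+ (#occurrences 0F (suc k)) (#occurrences 1F (suc k)))

0≤p*q⇒0≤p : ∀ {p q} → 0ℚ < q → 0ℚ ≤ p * q → 0ℚ ≤ p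
0≤p*q⇒0≤p {p} {q} 0<q 0≤pq = *-cancelʳ-≤-pos q {{positive 0<q}} (subst (_≤ p * q) (sym (*-zeroˡ q)) 0≤pq)

module _ {q : ℚ} (near : Near q) (k : ℕ) (balanced : Balanced k q) where

  private
    n m : ℚ
    n = nat (#occurrences 0F (suc k))
    m = nat (#occurrences 1F (suc k))

    0<q-1 : 0ℚ < q - 1ℚ
    0<q-1 = p<q⇒0<q-p (<-≤-trans (from-yes (1ℚ <? ψ⁻)) (proj₁ near))

  position≤ψn : ∀ {ε} → 0ℚ < ε → n + m + - (+ 2 / 1) ≤ q * n + ε
  position≤ψn {ε} 0<ε = ≤-by
    (p≤q⇒0≤q-p (proj₂ balanced) ⊕ (⟨ + 2 / 5 ⟩ ⊕ <⇒≤ 0<ε))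
    (ψ-lower-identity n m q ε)

  ψn<position : q * n + ½ ≤ n + m + - (+ 2 / 1) + + 5 / 1
  ψn<position = ≤-by (p≤q⇒0≤q-p (proj₁ balanced)) (ψ-upper-identity n m q)

  module _ (small : ∣ ½ * m * χ q ∣ < + 1 / 100) where

    position≤γm : n + m + - (+ 3 / 1) ≤ γ-of q * m
    -- Multiplied by q - 1 > 0, the difference becomes a sum of nonnegative terms.
    position≤γm = ≤-by (0≤p*q⇒0≤p 0<q-1 (subst (0ℚ ≤_) (γ-lower-identity n m q ψ⁻)
      (p≤q⇒0≤q-p (proj₁ balanced)
        ⊕ p≤q⇒0≤q-p (≤-trans (neg-antimono-≤ (<⇒≤ small)) (-∣p∣≤p (½ * m * χ q)))
        ⊕ (⟨ + 3 / 1 ⟩ ⊗ p≤q⇒0≤q-p (proj₁ near) ⊕ ⟨ + 3 / 1 * (ψ⁻ - 1ℚ) - + 251 / 100 ⟩)))) refl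

    γm<position : γ-of q * m + + 1 / 100 ≤ n + m + - (+ 3 / 1) + + 5 / 1
    γm<position = ≤-by (0≤p*q⇒0≤p 0<q-1 (subst (0ℚ ≤_) (γ-upper-identity n m q ψ⁻)
      (p≤q⇒0≤q-p (proj₂ balanced)
        ⊕ p≤q⇒0≤q-p (≤-trans (p≤∣p∣ (½ * m * χ q)) (<⇒≤ small))
        ⊕ (⟨ + 199 / 100 ⟩ ⊗ p≤q⇒0≤q-p (proj₁ near) ⊕ ⟨ + 199 / 100 * (ψ⁻ - 1ℚ) - + 161 / 100 ⟩)))) refl

p-c≤m⇒p≤m+c : ∀ {p c m} → p ℤ.- c ℤ.≤ m → p ℤ.≤ m ℤ.+ c
p-c≤m⇒p≤m+c {p} {c} {m} le = subst (ℤ._≤ m ℤ.+ c) (cancel-c p c) (ℤ.+-monoˡ-≤ c le)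
  where
  cancel-c : ∀ p c → p ℤ.- c ℤ.+ c ≡ p
  cancel-c = ℤ-solve-∀

m≤p-c+[c+d]⇒m-d≤p : ∀ {p c d m} → m ℤ.≤ p ℤ.- c ℤ.+ (c ℤ.+ d) → m ℤ.- d ℤ.≤ p
m≤p-c+[c+d]⇒m-d≤p {p} {c} {d} {m} le = subst (m ℤ.- d ℤ.≤_) (cancel-cd p c d) (ℤ.+-monoˡ-≤ (ℤ.- d) le)
  where
  cancel-cd : ∀ p c d → p ℤ.- c ℤ.+ (c ℤ.+ d) ℤ.- d ≡ p
  cancel-cd = ℤ-solve-∀

-- Floors of ψn and γn

module _ (ψ : ℝ) (root : ψ ^ᵣ 3 -ᵣ ψ ^ᵣ 2 -ᵣ ψ -ᵣ fromℕ 1 ≃ᵣ fromℕ 0) where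

  private
    γ : ℝ
    γ = (ψ ^ᵣ 2 +ᵣ fromℕ 1) *ᵣ fromℚ ½

  compare-ψ : ∀ t → fromℚ t ≤ᵣ ψ ⊎ ψ <ᵣ fromℚ t
  compare-ψ = ≤-or-> ψ χ χ-slope (χ-negligible ψ root) χ-factor (positive⁻¹ (+ 1 / 3))
    (λ t → eventually
      (λ near → χ-slope-lower t (≤-trans (from-yes (+ 11 / 6 ≤? ψ⁻)) (proj₁ near))) (near ψ root))
    (λ t → bounded ψ (fromℚ t *ᵣ fromℚ t +ᵣ fromℚ t *ᵣ ψ +ᵣ ψ *ᵣ ψ -ᵣ fromℚ t -ᵣ ψ -ᵣ fromℚ 1ℚ) (λ _ → refl))

  -- Each term of γ is, by computation, `γ-of` of the corresponding term of ψ.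
  at-γ : ∀ {P : ℚ → Set} → Eventually ψ (λ q → P (γ-of q)) → Eventually γ P
  at-γ (mkEventually ev) = mkEventually ev

  compare-γ : ∀ t → fromℚ t ≤ᵣ γ ⊎ γ <ᵣ fromℚ t
  compare-γ = ≤-or-> γ μ μ-slope
    (λ ε 0<ε → at-γ (negligible-resp ψ μ-γ
      (negligible-* ψ {μ-cofactor} {χ}
        (bounded ψ ((ψ *ᵣ ψ *ᵣ ψ +ᵣ ψ *ᵣ ψ -ᵣ ψ +ᵣ fromℚ 1ℚ) *ᵣ fromℚ (½ * ½ * ½)) (λ _ → refl))
        (χ-negligible ψ root)) ε 0<ε))
    μ-factor (positive⁻¹ (+ 1 / 20))
    (λ t → at-γ (eventually (λ near → μ-slope-lower t (γ-lower near)) (near ψ root)))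
    (λ t → bounded γ (fromℚ t *ᵣ fromℚ t +ᵣ fromℚ t *ᵣ γ +ᵣ γ *ᵣ γ
                     -ᵣ fromℚ (1ℚ + 1ℚ + 1ℚ) *ᵣ (fromℚ t +ᵣ γ) +ᵣ fromℚ (1ℚ + 1ℚ)) (λ _ → refl))

  I₀-bounds : ∀ n k → n ℕ.≥ 1 → #occurrences 0F (suc k) ≡ n →
    ∃[ m ] (⌊ ψ *ᵣ fromℕ n ⌋≡ m × m ℤ.- + 2 ℤ.≤ + suc k × + suc k ℤ.≤ m ℤ.+ + 2)
  I₀-bounds n k n≥1 refl =
    let m , ⌊⌋≡m , l≤m , m≤ = floor-between (ψ *ᵣ fromℕ n)
                               (compare-multiple ψ compare-ψ n n≥1) 4 l lower upper
    in m , ⌊⌋≡m , m≤p-c+[c+d]⇒m-d≤p {+ suc k} {+ 2} {+ 2} m≤ , p-c≤m⇒p≤m+c {+ suc k} {+ 2} l≤m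
    where
    -- For the position p, the floor is one of the five integers from p - 2 to p + 2.
    l = + suc k ℤ.- + 2
    l≡ : l / 1 ≡ nat (#occurrences 0F (suc k)) + nat (#occurrences 1F (suc k)) + - (+ 2 / 1)
    l≡ = trans (/1-+ (+ suc k) (ℤ.- + 2)) (cong (λ p → p + - (+ 2 / 1)) (position k))
    facts = near ψ root ∧ balanced ψ root k
    lower : fromℤ l ≤ᵣ ψ *ᵣ fromℕ n
    lower ε 0<ε = holds (eventually {x = ψ}
      (λ {q} (near , bal) → subst (_≤ q * nat n + ε) (sym l≡) (position≤ψn near k bal 0<ε)) facts)
    upper : ψ *ᵣ fromℕ n <ᵣ fromℤ (l ℤ.+ + 5)
    upper = ½ , positive⁻¹ ½ , holds (eventually {x = ψ}
      (λ {q} (near , bal) → subst (q * nat n + ½ ≤_)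
        (sym (trans (/1-+ l (+ 5)) (cong (λ p → p + + 5 / 1) l≡)))
        (ψn<position near k bal)) facts)

  I₁-bounds : ∀ n k → n ℕ.≥ 1 → #occurrences 1F (suc k) ≡ n →
    ∃[ m ] (⌊ γ *ᵣ fromℕ n ⌋≡ m × m ℤ.- + 1 ℤ.≤ + suc k × + suc k ℤ.≤ m ℤ.+ + 3)
  I₁-bounds n k n≥1 refl =
    let m , ⌊⌋≡m , l≤m , m≤ = floor-between (γ *ᵣ fromℕ n)
                               (compare-multiple γ compare-γ n n≥1) 4 l lower upper
    in m , ⌊⌋≡m , m≤p-c+[c+d]⇒m-d≤p {+ suc k} {+ 3} {+ 1} m≤ , p-c≤m⇒p≤m+c {+ suc k} {+ 3} l≤m
    where
    -- Here the candidates run from p - 3 to p + 1, which gives the asymmetric bounds.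
    l = + suc k ℤ.- + 3
    l≡ : l / 1 ≡ nat (#occurrences 0F (suc k)) + nat (#occurrences 1F (suc k)) + - (+ 3 / 1)
    l≡ = trans (/1-+ (+ suc k) (ℤ.- + 3)) (cong (λ p → p + - (+ 3 / 1)) (position k))
    small : Eventually ψ (λ q → ∣ ½ * nat n * χ q ∣ < + 1 / 100)
    small = negligible-* ψ {λ _ → ½ * nat n} {χ} (bounded ψ (fromℚ (½ * nat n)) (λ _ → refl))
              (χ-negligible ψ root) (+ 1 / 100) (positive⁻¹ (+ 1 / 100))
    facts = near ψ root ∧ balanced ψ root k ∧ small
    lower : fromℤ l ≤ᵣ γ *ᵣ fromℕ n
    lower ε 0<ε = holds (eventually {x = ψ}
      (λ {q} (near , bal , small) → begin
        l / 1                      ≡⟨ l≡ ⟩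
        _                          ≤⟨ position≤γm near k bal small ⟩
        γ-of q * nat n             ≡⟨ +-identityʳ (γ-of q * nat n) ⟨
        γ-of q * nat n + 0ℚ        ≤⟨ +-monoʳ-≤ (γ-of q * nat n) (<⇒≤ 0<ε) ⟩
        γ-of q * nat n + ε         ∎) facts)
      where open ≤-Reasoning
    upper : γ *ᵣ fromℕ n <ᵣ fromℤ (l ℤ.+ + 5)
    upper = + 1 / 100 , positive⁻¹ (+ 1 / 100) , holds (eventually {x = ψ}
      (λ {q} (near , bal , small) → subst (γ-of q * nat n + + 1 / 100 ≤_)
        (sym (trans (/1-+ l (+ 5)) (cong (λ p → p + + 5 / 1) l≡)))
        (γm<position near k bal small)) facts)

theorem4 : (ψ : ℝ) →
    ψ ^ᵣ 3 -ᵣ ψ ^ᵣ 2 -ᵣ ψ -ᵣ fromℕ 1 ≃ᵣ fromℕ 0 →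
    let γ = (ψ ^ᵣ 2 +ᵣ fromℕ 1) *ᵣ fromℚ ½ in
    (n : ℕ) → n ℕ.≥ 1 →
    (∃[ p ] ∃[ m ] (I 0F [ n ]≡ p × ⌊ ψ *ᵣ fromℕ n ⌋≡ m ×
                    m ℤ.- + 2 ℤ.≤ + p × + p ℤ.≤ m ℤ.+ + 2)) ×
    (∃[ p ] ∃[ m ] (I 1F [ n ]≡ p × ⌊ γ *ᵣ fromℕ n ⌋≡ m ×
                    m ℤ.- + 1 ℤ.≤ + p × + p ℤ.≤ m ℤ.+ + 3))
theorem4 ψ root n n≥1 =
  let k , 𝐁k≡0 , #0≡n = occurrence 0F n n≥1
      l , 𝐁l≡1 , #1≡n = occurrence 1F n n≥1
      i , ⌊ψn⌋≡i , i-2≤ , ≤i+2 = I₀-bounds ψ root n k n≥1 #0≡n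
      j , ⌊γn⌋≡j , j-1≤ , ≤j+3 = I₁-bounds ψ root n l n≥1 #1≡n
  in (suc k , i , (𝐁k≡0 , #0≡n) , ⌊ψn⌋≡i , i-2≤ , ≤i+2)
   , (suc l , j , (𝐁l≡1 , #1≡n) , ⌊γn⌋≡j , j-1≤ , ≤j+3)
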